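{- Let $D$ be a connected ribbon with an odd number of boxes that is not a basic block. If the length of $D$ is even, then $\mathfrak{r}_D$ is not $p$-positive.
   Context: Boxes are indexed $(i,j)$, row $i$ from the top, column $j$ from the left. For a composition $\alpha=(\alpha_1,\dots,\alpha_\ell)$, the connected ribbon $\alpha$ is the set of boxes in which row $i$ has $\alpha_i$ consecutive boxes and, for $i<\ell$, the leftmost box of row $i$ lies directly above the rightmost box of row $i+1$; its length is $\ell$. A marked shifted tableau of it is a filling by letters of $\{1'<1<2'<2<\cdots\}$ with weakly increasing rows and columns, at most one unmarked $k$ per column and at most one $k'$ per row for each $k$; the content $(c_1,c_2,\dots)$ counts entries with unmarked value $i$. $\mathfrak{r}_D=\sum_Tx_1^{c_1}x_2^{c_2}\cdots$ over all such tableaux. $D^t$ is the reflection of $D$ in the main diagonal and $D^\circ$ its $180$-degree rotation. $\triangle_{n,k}$ ($1\le k\le n$) is the ribbon $(1^{k-1},n-k+1)$. The basic blocks of size $n$ are $\triangle_{n,1},\triangle_{n,1}^t,\triangle_{n,3},\triangle_{n,3}^t,\triangle_{n,3}^\circ,(\triangle_{n,3}^t)^\circ$ for $n\ge3$, and $\triangle_{n,1},\triangle_{n,1}^t$ for $n\le2$. A symmetric function is $p$-positive if all its coefficients in the power sum basis are nonnegative. -}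

module Defs where

open import Data.Nat using (ℕ; zero; suc; _+_; _*_; _∸_; _≤_; _<_; _%_; _/_)
import Data.Nat as ℕ
open import Data.Bool using (Bool; true; false; if_then_else_)
open import Data.Fin using (Fin; toℕ)
import Data.Fin as Fin
open import Data.Fin.Properties using (all?)
open import Data.List using (List; []; _∷_; map; _++_; length; upTo; allFin; concatMap; filter; replicate; foldr)
open import Data.Nat.ListAction using (sum)
import Data.List as List
open import Data.List.Relation.Unary.All using (All)
open import Data.List.Relation.Unary.Linked using (Linked)
open import Data.Vec using (Vec; []; _∷_; lookup; tabulate)
open import Data.Vec.Properties using (≡-dec)
open import Data.Product using (Σ; _×_; _,_; proj₁; proj₂)
open import Data.Integer using (+_)
open import Data.Rational using (ℚ; 0ℚ) renaming (_+_ to _+ℚ_; _*_ to _*ℚ_; _≤_ to _≤ℚ_; _/_ to _/ℚ_)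
open import Relation.Binary.PropositionalEquality using (_≡_; _≢_)
open import Relation.Nullary using (Dec; yes; no; does; ¬_)
open import Data.List.Membership.Propositional using (_∈_)
open import Relation.Nullary.Decidable using (_×-dec_; _→-dec_; ¬?)

IsComposition : List ℕ → Set
IsComposition α = All (λ a → 1 ≤ a) α

-- column of the leftmost box of the top row of the ribbon (as),
-- when its bottom row starts in column 1 (minus 1)
offset : List ℕ → ℕ
offset as = sum (map (λ b → b ∸ 1) as)

-- boxes (row , column) of the ribbon with rows α, top row having index r;
-- row i has α_i consecutive boxes and the leftmost box of row i lies
-- directly above the rightmost box of row i+1.
ribbonBoxesFrom : ℕ → List ℕ → List (ℕ × ℕ)
ribbonBoxesFrom r [] = []
ribbonBoxesFrom r (a ∷ as) =
  map (λ j → (r , suc (offset as + j))) (upTo a) ++ ribbonBoxesFrom (suc r) as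

-- the connected ribbon α (rows numbered from 1 at the top; the bottom row
-- starts in column 1)
ribbon : List ℕ → List (ℕ × ℕ)
ribbon α = ribbonBoxesFrom 1 α

triangle : ℕ → ℕ → List ℕ
triangle n k = replicate (k ∸ 1) 1 ++ (suc n ∸ k ∷ [])

-- the compositions of the basic blocks of size n:
--  △_{n,1} = (n), △_{n,1}^t = (1^n),
--  △_{n,3} = (1,1,n-2), △_{n,3}^t = (1^{n-3},3),
--  △_{n,3}^∘ = (n-2,1,1), (△_{n,3}^t)^∘ = (3,1^{n-3})
basicBlocks : ℕ → List (List ℕ)
basicBlocks n with n ℕ.<? 3
... | yes _ = triangle n 1 ∷ replicate n 1 ∷ []
... | no _ =
  triangle n 1 ∷ replicate n 1 ∷
  triangle n 3 ∷ (replicate (n ∸ 3) 1 ++ (3 ∷ [])) ∷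
  List.reverse (triangle n 3) ∷ List.reverse (replicate (n ∸ 3) 1 ++ (3 ∷ [])) ∷ []

IsBasicBlock : List ℕ → Set
IsBasicBlock α = α ∈ basicBlocks (sum α)

-- Marked shifted tableaux with letters from {1' < 1 < 2' < 2 < ... < N' < N}
-- A letter is encoded by a code c : Fin (2 * N):  code 2i is (i+1)' and
-- code 2i+1 is (i+1) (i = 0 .. N-1); the order of letters is the order of codes.

IsMarked : ℕ → Set
IsMarked c = c % 2 ≡ 0

-- unmarked value (0-indexed: value v means the letter v+1 or (v+1)')
value : ℕ → ℕ
value c = c / 2

PairCond : (N : ℕ) (B : List (ℕ × ℕ)) → Vec (Fin (2 * N)) (length B) →
           Fin (length B) → Fin (length B) → Set
PairCond N B T p q =
  (proj₁ (List.lookup B p) ≡ proj₁ (List.lookup B q) →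
   proj₂ (List.lookup B p) < proj₂ (List.lookup B q) → toℕ (lookup T p) ≤ toℕ (lookup T q)) ×
  (proj₂ (List.lookup B p) ≡ proj₂ (List.lookup B q) →
   proj₁ (List.lookup B p) < proj₁ (List.lookup B q) → toℕ (lookup T p) ≤ toℕ (lookup T q)) ×
  (p ≢ q → proj₂ (List.lookup B p) ≡ proj₂ (List.lookup B q) →
   lookup T p ≡ lookup T q → IsMarked (toℕ (lookup T p))) ×
  (p ≢ q → proj₁ (List.lookup B p) ≡ proj₁ (List.lookup B q) →
   lookup T p ≡ lookup T q → ¬ IsMarked (toℕ (lookup T p)))

IsMarkedShiftedTableau : (N : ℕ) (B : List (ℕ × ℕ)) → Vec (Fin (2 * N)) (length B) → Set
IsMarkedShiftedTableau N B T = ∀ p q → PairCond N B T p q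

pairCond? : (N : ℕ) (B : List (ℕ × ℕ)) (T : Vec (Fin (2 * N)) (length B)) →
            ∀ p q → Dec (PairCond N B T p q)
pairCond? N B T p q =
  ((proj₁ (List.lookup B p) ℕ.≟ proj₁ (List.lookup B q)) →-dec
   ((proj₂ (List.lookup B p) ℕ.<? proj₂ (List.lookup B q)) →-dec (toℕ (lookup T p) ℕ.≤? toℕ (lookup T q)))) ×-dec
  (((proj₂ (List.lookup B p) ℕ.≟ proj₂ (List.lookup B q)) →-dec
   ((proj₁ (List.lookup B p) ℕ.<? proj₁ (List.lookup B q)) →-dec (toℕ (lookup T p) ℕ.≤? toℕ (lookup T q)))) ×-dec
  ((¬? (p Fin.≟ q) →-dec ((proj₂ (List.lookup B p) ℕ.≟ proj₂ (List.lookup B q)) →-dec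
     ((lookup T p Fin.≟ lookup T q) →-dec (toℕ (lookup T p) % 2 ℕ.≟ 0)))) ×-dec
   (¬? (p Fin.≟ q) →-dec ((proj₁ (List.lookup B p) ℕ.≟ proj₁ (List.lookup B q)) →-dec
     ((lookup T p Fin.≟ lookup T q) →-dec ¬? (toℕ (lookup T p) % 2 ℕ.≟ 0))))))

isMarkedShiftedTableau? : (N : ℕ) (B : List (ℕ × ℕ)) (T : Vec (Fin (2 * N)) (length B)) →
                          Dec (IsMarkedShiftedTableau N B T)
isMarkedShiftedTableau? N B T =
  all? {P = λ p → ∀ q → PairCond N B T p q} (λ p → all? {P = PairCond N B T p} (pairCond? N B T p))

content : (N : ℕ) (B : List (ℕ × ℕ)) → Vec (Fin (2 * N)) (length B) → Vec ℕ N
content N B T = tabulate (λ i → length (filter (λ p → value (toℕ (lookup T p)) ℕ.≟ toℕ i) (allFin (length B))))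

allVec : (m k : ℕ) → List (Vec (Fin m) k)
allVec m zero = [] ∷ []
allVec m (suc k) = concatMap (λ i → map (i ∷_) (allVec m k)) (allFin m)

-- Symmetric functions are represented through their specialisations to
-- N variables x_1..x_N (x_{N+1} = ... = 0), for every N: a family
-- F N : Vec ℕ N → coefficient of the monomial x^a.

rCoeff : List (ℕ × ℕ) → (N : ℕ) → Vec ℕ N → ℕ
rCoeff B N a =
  length (filter (λ T → isMarkedShiftedTableau? N B T ×-dec ≡-dec ℕ._≟_ (content N B T) a)
                 (allVec (2 * N) (length B)))

-- the exponent vector of the monomial x_{g_1}^{μ_1} x_{g_2}^{μ_2} ...
pWeight : (μ : List ℕ) {N : ℕ} → Vec (Fin N) (length μ) → Vec ℕ N
pWeight μ g = tabulate (λ i →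
  sum (map (λ k → if does (lookup g k Fin.≟ i) then List.lookup μ k else 0) (allFin (length μ))))

-- coefficient of x^a in p_μ(x_1, ..., x_N) = ∏_k (x_1^{μ_k} + ... + x_N^{μ_k})
pCoeff : List ℕ → (N : ℕ) → Vec ℕ N → ℕ
pCoeff μ N a = length (filter (λ g → ≡-dec ℕ._≟_ (pWeight μ g) a) (allVec N (length μ)))

IsPartition : List ℕ → Set
IsPartition μ = All (λ m → 1 ≤ m) μ × Linked ℕ._≥_ μ

ℕtoℚ : ℕ → ℚ
ℕtoℚ n = (+ n) /ℚ 1

sumℚ : List ℚ → ℚ
sumℚ = foldr _+ℚ_ 0ℚ

-- p-positivity: the symmetric function is a linear combination of power
-- sums p_μ with nonnegative rational coefficients (since the p_μ form a
-- basis, this says exactly that all its p-coefficients are nonnegative)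
PPositive : ((N : ℕ) → Vec ℕ N → ℕ) → Set
PPositive F =
  Σ (List (ℚ × List ℕ)) λ ts →
    All (λ t → (0ℚ ≤ℚ proj₁ t) × IsPartition (proj₂ t)) ts ×
    (∀ (N : ℕ) (a : Vec ℕ N) →
       ℕtoℚ (F N a) ≡ sumℚ (map (λ t → proj₁ t *ℚ ℕtoℚ (pCoeff (proj₂ t) N a)) ts))

𝔯 : List ℕ → (N : ℕ) → Vec ℕ N → ℕ
𝔯 α = rCoeff (ribbon α)

{-# OPTIONS --safe #-}
module Submission where

-- Under x₁ = … = x_N = 1 the power sum p_μ becomes N^ℓ(μ), so for F homogeneous of degree n the
-- coefficient of p_n in F is the coefficient of N in the polynomial F(1^N).  For the ribbon α this
-- polynomial counts words in 2N letters with a prescribed descent set; splitting a ribbon between two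
-- rows gives f_α f_β = f_{α·β} + f_{α⊙β}, and products have no linear term, so each additional row of α
-- flips the sign of the linear coefficient.  For one row of n boxes the count is the coefficient of
-- tⁿ in ((1 + t) / (1 − t))^N = exp (2N (t + t³/3 + …)), whose linear term is positive for odd n.
-- Hence the coefficient of p_n is negative when n is odd and the length is even.
-- Linear coefficients are compared modulo N² after clearing denominators.

open import Defs
open import Data.Nat using (ℕ; _%_)
open import Data.List using (List; length)
open import Data.Nat.ListAction using (sum)
open import Relation.Binary.PropositionalEquality using (_≡_)
open import Relation.Nullary using (¬_)

open import Data.Bool using (Bool; true; false; if_then_else_; not; _∧_)
open import Data.Fin using (Fin; zero; suc; toℕ; fromℕ<)
import Data.Fin as Fin
import Data.Fin.Properties as Fin
open import Data.Integer as ℤ using (ℤ; -1ℤ) renaming (+_ to ⁺_)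
import Data.Integer.Properties as ℤ
import Data.Integer.Tactic.RingSolver as ℤ-Solver
open import Data.List using ([]; _∷_; map; _++_; concatMap; filter; allFin; upTo; applyUpTo)
import Data.List as List
open import Data.List.Properties using (map-tabulate; map-∘; map-cong; map-applyUpTo; length-map)
open import Data.List.Relation.Unary.All as All using (All; []; _∷_)
import Data.List.Relation.Unary.All.Properties as All
open import Data.List.Relation.Unary.AllPairs using (AllPairs; []; _∷_; allPairs?)
import Data.List.Relation.Unary.AllPairs.Properties as AllPairs
open import Data.List.Relation.Unary.Linked using (Linked; linked?)
open import Data.List.Relation.Unary.Linked.Properties using (Linked⇒AllPairs; AllPairs⇒Linked)
open import Data.Nat using (zero; suc; pred; _+_; _*_; _^_; _≤_; _<_; _≟_; _<?_; z<s; s≤s; >-nonZero)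
open import Data.Nat.Divisibility using (divides; >⇒∤)
open import Data.Nat.DivMod using (m<n*o⇒m/o<n)
open import Data.Nat.Properties
import Data.Nat.Tactic.RingSolver as ℕ-Solver
open import Data.Product using (_×_; _,_; proj₁; proj₂; ∃-syntax)
open import Data.Rational as ℚ using (ℚ; 0ℚ; mkℚ)
import Data.Rational.Properties as ℚ
open import Data.Rational.Unnormalised as ℚᵘ using (mkℚᵘ; *≡*)
import Data.Rational.Unnormalised.Properties as ℚᵘ
open import Data.Sum using (_⊎_; inj₁; inj₂)
open import Data.Vec using (Vec; []; _∷_; lookup; tabulate; toList; head)
import Data.Vec as Vec
open import Data.Vec.Properties using (≡-dec)
open import Function using (id; _∘_; _⇔_; mk⇔; Equivalence)
open import Relation.Binary.PropositionalEquality using (_≢_; refl; sym; trans; cong; cong₂; subst; ≢-sym; module ≡-Reasoning)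
import Relation.Binary.Reasoning.Setoid ℚᵘ.≃-setoid as ≃-Reasoning
open import Relation.Nullary using (Dec; yes; no; does; contradiction)
open import Relation.Nullary.Decidable using (_×-dec_; _⊎-dec_; _→-dec_; ¬?; does-⇔; dec-true; decidable-stable)
open import Relation.Unary using (Decidable)

-- No polynomials are formed: for every `N` some integer `k`, allowed to depend on `N`, gives
-- `M f(N) = a N + k N²`. This weak form survives sums and products, yet it still fixes the sign of
-- the slope, since two expansions with slopes of opposite sign would make every positive `N` divide
-- one fixed positive number. The slopes of one-row counts come from a recurrence in the number of
-- boxes rather than from the exponential. It links `n` to `n + 2`, and its term with `n + 1` boxes
-- carries an extra factor `N`, so the two parity classes do not mix modulo `N²`. The power sum
-- expansion is taken as given, possibly with terms of several degrees; summing coefficients over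
-- exponent vectors of degree `n` alone discards the other degrees.

private variable
  A A′ X : Set
  m : ℕ

-- Specialisation at (1, …, 1)

⟦_⟧ : Bool → ℕ
⟦ b ⟧ = if b then 1 else 0

⟦∧⟧ : ∀ b c → ⟦ b ∧ c ⟧ ≡ ⟦ b ⟧ * ⟦ c ⟧
⟦∧⟧ false c = refl
⟦∧⟧ true c = sym (+-identityʳ _)

⟦b⟧+⟦¬b⟧ : ∀ b → ⟦ not b ⟧ + ⟦ b ⟧ ≡ 1
⟦b⟧+⟦¬b⟧ false = refl
⟦b⟧+⟦¬b⟧ true = refl

∑ : List A → (A → ℕ) → ℕ
∑ xs f = sum (map f xs)

∑-cong : ∀ {f g : A → ℕ} xs → (∀ x → f x ≡ g x) → ∑ xs f ≡ ∑ xs g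
∑-cong xs f≗g = cong sum (map-cong f≗g xs)

∑-++ : ∀ (f : A → ℕ) xs ys → ∑ (xs ++ ys) f ≡ ∑ xs f + ∑ ys f
∑-++ f [] ys = refl
∑-++ f (x ∷ xs) ys = trans (cong (f x +_) (∑-++ f xs ys)) (sym (+-assoc (f x) _ _))

∑-map : ∀ (f : A′ → ℕ) (g : A → A′) xs → ∑ (map g xs) f ≡ ∑ xs (f ∘ g)
∑-map f g xs = cong sum (sym (map-∘ xs))

∑-concatMap : ∀ (f : A′ → ℕ) (g : A → List A′) xs → ∑ (concatMap g xs) f ≡ ∑ xs (λ x → ∑ (g x) f)
∑-concatMap f g [] = refl
∑-concatMap f g (x ∷ xs) =
  trans (∑-++ f (g x) (concatMap g xs)) (cong (∑ (g x) f +_) (∑-concatMap f g xs))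

∑-0 : ∀ (xs : List A) → ∑ xs (λ _ → 0) ≡ 0
∑-0 [] = refl
∑-0 (x ∷ xs) = ∑-0 xs

∑-1 : ∀ (xs : List A) → ∑ xs (λ _ → 1) ≡ length xs
∑-1 [] = refl
∑-1 (x ∷ xs) = cong suc (∑-1 xs)

∑-+ : ∀ (f g : A → ℕ) xs → ∑ xs (λ x → f x + g x) ≡ ∑ xs f + ∑ xs g
∑-+ f g [] = refl
∑-+ f g (x ∷ xs) = trans (cong (f x + g x +_) (∑-+ f g xs)) (interchange (f x) (g x) _ _)
  where
  interchange : ∀ a b c d → a + b + (c + d) ≡ a + c + (b + d)
  interchange = ℕ-Solver.solve-∀

∑-*ˡ : ∀ c (f : A → ℕ) xs → ∑ xs (λ x → c * f x) ≡ c * ∑ xs f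
∑-*ˡ c f [] = sym (*-zeroʳ c)
∑-*ˡ c f (x ∷ xs) = trans (cong (c * f x +_) (∑-*ˡ c f xs)) (sym (*-distribˡ-+ c (f x) _))

∑-*ʳ : ∀ c (f : A → ℕ) xs → ∑ xs (λ x → f x * c) ≡ ∑ xs f * c
∑-*ʳ c f xs = trans (∑-cong xs (λ x → *-comm (f x) c)) (trans (∑-*ˡ c f xs) (*-comm c _))

∑-swap : ∀ (f : A → A′ → ℕ) xs ys → ∑ xs (λ x → ∑ ys (f x)) ≡ ∑ ys (λ y → ∑ xs (λ x → f x y))
∑-swap f [] ys = sym (∑-0 ys)
∑-swap f (x ∷ xs) ys =
  trans (cong (∑ ys (f x) +_) (∑-swap f xs ys)) (sym (∑-+ (f x) (λ y → ∑ xs (λ x′ → f x′ y)) ys))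

length-filter : ∀ {P : A → Set} (P? : Decidable P) xs → length (filter P? xs) ≡ ∑ xs (λ x → ⟦ does (P? x) ⟧)
length-filter P? [] = refl
length-filter P? (x ∷ xs) with does (P? x)
... | true = cong suc (length-filter P? xs)
... | false = length-filter P? xs

∑-allFin-suc : ∀ {n} (f : Fin (suc n) → ℕ) → ∑ (allFin (suc n)) f ≡ f zero + ∑ (allFin n) (f ∘ suc)
∑-allFin-suc {n} f = cong (f zero +_)
  (trans (cong (λ xs → ∑ xs f) (sym (map-tabulate id suc))) (∑-map f suc (allFin n)))

∑-δ : ∀ {n} (j : Fin n) c → ∑ (allFin n) (λ i → if does (j Fin.≟ i) then c else 0) ≡ c
∑-δ {suc n} zero c = trans (∑-allFin-suc {n} (λ i → if does (zero Fin.≟ i) then c else 0))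
  (trans (cong (c +_) (∑-0 (allFin n))) (+-identityʳ c))
∑-δ {suc n} (suc j) c = trans (∑-allFin-suc {n} (λ i → if does (suc j Fin.≟ i) then c else 0)) (∑-δ j c)

∑-lookup : ∀ μ → ∑ (allFin (length μ)) (List.lookup μ) ≡ sum μ
∑-lookup [] = refl
∑-lookup (m ∷ μ) = trans (∑-allFin-suc (List.lookup (m ∷ μ))) (cong (m +_) (∑-lookup μ))

sum-tabulate : ∀ {n} (f : Fin n → ℕ) → Vec.sum (tabulate f) ≡ ∑ (allFin n) f
sum-tabulate {zero} f = refl
sum-tabulate {suc n} f = trans (cong (f zero +_) (sum-tabulate (f ∘ suc))) (sym (∑-allFin-suc f))

length-allFin : ∀ n → length (allFin n) ≡ n
length-allFin zero = refl
length-allFin (suc n) = cong suc (trans (cong length (sym (map-tabulate {n = n} id suc)))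
  (trans (length-map suc (allFin n)) (length-allFin n)))

∑-allVec-suc : ∀ {m k} (f : Vec (Fin m) (suc k) → ℕ) →
  ∑ (allVec m (suc k)) f ≡ ∑ (allFin m) (λ i → ∑ (allVec m k) (λ v → f (i ∷ v)))
∑-allVec-suc {m} {k} f = trans (∑-concatMap f (λ i → map (i ∷_) (allVec m k)) (allFin m))
  (∑-cong (allFin m) (λ i → ∑-map f (i ∷_) (allVec m k)))

∑-allVec-1 : ∀ m k → ∑ (allVec m k) (λ _ → 1) ≡ m ^ k
∑-allVec-1 m zero = refl
∑-allVec-1 m (suc k) = begin
  ∑ (allVec m (suc k)) (λ _ → 1)                       ≡⟨ ∑-allVec-suc {m} {k} (λ _ → 1) ⟩
  ∑ (allFin m) (λ _ → ∑ (allVec m k) (λ _ → 1))        ≡⟨ ∑-cong (allFin m) (λ _ → trans (∑-allVec-1 m k) (sym (+-identityʳ _))) ⟩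
  ∑ (allFin m) (λ _ → 1 * m ^ k)                       ≡⟨ ∑-*ʳ (m ^ k) (λ _ → 1) (allFin m) ⟩
  ∑ (allFin m) (λ _ → 1) * m ^ k                       ≡⟨ cong (_* m ^ k) (trans (∑-1 (allFin m)) (length-allFin m)) ⟩
  m ^ suc k                                            ∎
  where open ≡-Reasoning

-- Summing coefficients over the exponent vectors of one degree

incHead : ∀ {N} → Vec ℕ (suc N) → Vec ℕ (suc N)
incHead (x ∷ v) = suc x ∷ v

-- Pascal-type recursion: the first part is either zero or arises from a smaller one by adding one,
-- so no vector is listed twice.
weakCompositions : ℕ → (N : ℕ) → List (Vec ℕ N)
weakCompositions zero zero = [] ∷ []
weakCompositions (suc n) zero = []
weakCompositions zero (suc N) = map (0 ∷_) (weakCompositions zero N)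
weakCompositions (suc n) (suc N) =
  map (0 ∷_) (weakCompositions (suc n) N) ++ map incHead (weakCompositions n (suc N))

infix 4 _≟ᵥ_
_≟ᵥ_ : ∀ {N} (v w : Vec ℕ N) → Dec (v ≡ w)
_≟ᵥ_ = ≡-dec _≟_

-- Exhaustiveness and absence of repetitions in one counting statement, the form that is used after
-- exchanging two sums.
∑-weakCompositions : ∀ n {N} (v : Vec ℕ N) →
  ∑ (weakCompositions n N) (λ a → ⟦ does (v ≟ᵥ a) ⟧) ≡ ⟦ does (Vec.sum v ≟ n) ⟧
∑-weakCompositions zero [] = refl
∑-weakCompositions (suc n) [] = refl
∑-weakCompositions zero {suc N} (zero ∷ v) = trans (∑-map _ (0 ∷_) (weakCompositions zero N)) (∑-weakCompositions zero v)
∑-weakCompositions zero {suc N} (suc x ∷ v) = trans (∑-map _ (0 ∷_) (weakCompositions zero N)) (∑-0 (weakCompositions zero N))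
∑-weakCompositions (suc n) {suc N} (zero ∷ v) = begin
  ∑ (L ++ R) f   ≡⟨ ∑-++ f L R ⟩
  ∑ L f + ∑ R f  ≡⟨ cong₂ _+_ (trans (∑-map f (0 ∷_) (weakCompositions (suc n) N)) (∑-weakCompositions (suc n) v))
                       (trans (∑-map f incHead (weakCompositions n (suc N)))
                         (trans (∑-cong (weakCompositions n (suc N)) (λ { (_ ∷ _) → refl })) (∑-0 (weakCompositions n (suc N))))) ⟩
  _ + 0          ≡⟨ +-identityʳ _ ⟩
  _              ∎
  where
  open ≡-Reasoning
  L = map (0 ∷_) (weakCompositions (suc n) N)
  R = map incHead (weakCompositions n (suc N))
  f : Vec ℕ (suc N) → ℕ
  f a = ⟦ does (zero ∷ v ≟ᵥ a) ⟧
∑-weakCompositions (suc n) {suc N} (suc x ∷ v) = begin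
  ∑ (L ++ R) f   ≡⟨ ∑-++ f L R ⟩
  ∑ L f + ∑ R f  ≡⟨ cong₂ _+_ (trans (∑-map f (0 ∷_) (weakCompositions (suc n) N)) (∑-0 (weakCompositions (suc n) N)))
                       (trans (∑-map f incHead (weakCompositions n (suc N)))
                         (trans (∑-cong (weakCompositions n (suc N)) (λ { (_ ∷ _) → refl })) (∑-weakCompositions n (x ∷ v)))) ⟩
  _              ∎
  where
  open ≡-Reasoning
  L = map (0 ∷_) (weakCompositions (suc n) N)
  R = map incHead (weakCompositions n (suc N))
  f : Vec ℕ (suc N) → ℕ
  f a = ⟦ does (suc x ∷ v ≟ᵥ a) ⟧

-- Summing the coefficients of degree n is the specialisation x₁ = … = x_N = 1.
∑-fibres : ∀ {n N} (F : A → Vec ℕ N) (w : A → ℕ) xs →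
  ∑ (weakCompositions n N) (λ a → ∑ xs (λ x → w x * ⟦ does (F x ≟ᵥ a) ⟧))
    ≡ ∑ xs (λ x → w x * ⟦ does (Vec.sum (F x) ≟ n) ⟧)
∑-fibres {n = n} {N} F w xs =
  trans (∑-swap (λ a x → w x * ⟦ does (F x ≟ᵥ a) ⟧) (weakCompositions n N) xs)
    (∑-cong xs (λ x → trans (∑-*ˡ (w x) _ (weakCompositions n N)) (cong (w x *_) (∑-weakCompositions n (F x)))))

sum-pWeight : ∀ μ {N} (g : Vec (Fin N) (length μ)) → Vec.sum (pWeight μ g) ≡ sum μ
sum-pWeight μ {N} g = begin
  Vec.sum (pWeight μ g)                            ≡⟨ sum-tabulate {N} _ ⟩
  ∑ (allFin N) (λ i → ∑ (allFin (length μ)) (λ k → f i k)) ≡⟨ ∑-swap f (allFin N) (allFin (length μ)) ⟩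
  ∑ (allFin (length μ)) (λ k → ∑ (allFin N) (λ i → f i k)) ≡⟨ ∑-cong (allFin (length μ)) (λ k → ∑-δ (lookup g k) (List.lookup μ k)) ⟩
  ∑ (allFin (length μ)) (List.lookup μ)            ≡⟨ ∑-lookup μ ⟩
  sum μ                                            ∎
  where
  open ≡-Reasoning
  f : Fin N → Fin (length μ) → ℕ
  f i k = if does (lookup g k Fin.≟ i) then List.lookup μ k else 0

-- All monomials of `p_μ` have degree `sum μ`, so the degree test does not depend on the choice `g`:
-- either all `N ^ length μ` choices count or none does.
∑-pCoeff : ∀ μ n N → ∑ (weakCompositions n N) (pCoeff μ N) ≡ ⟦ does (sum μ ≟ n) ⟧ * N ^ length μ
∑-pCoeff μ n N = begin
  ∑ wc (pCoeff μ N)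
    ≡⟨ ∑-cong wc (λ a → trans (length-filter (λ g → pWeight μ g ≟ᵥ a) gs) (∑-cong gs (λ g → sym (+-identityʳ _)))) ⟩
  ∑ wc (λ a → ∑ gs (λ g → 1 * ⟦ does (pWeight μ g ≟ᵥ a) ⟧))
    ≡⟨ ∑-fibres (pWeight μ) (λ _ → 1) gs ⟩
  ∑ gs (λ g → 1 * ⟦ does (Vec.sum (pWeight μ g) ≟ n) ⟧)
    ≡⟨ ∑-cong gs (λ g → trans (*-comm 1 _) (cong (λ s → ⟦ does (s ≟ n) ⟧ * 1) (sum-pWeight μ g))) ⟩
  ∑ gs (λ g → ⟦ does (sum μ ≟ n) ⟧ * 1)
    ≡⟨ ∑-*ˡ ⟦ does (sum μ ≟ n) ⟧ (λ _ → 1) gs ⟩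
  ⟦ does (sum μ ≟ n) ⟧ * ∑ gs (λ _ → 1)
    ≡⟨ cong (⟦ does (sum μ ≟ n) ⟧ *_) (∑-allVec-1 N (length μ)) ⟩
  ⟦ does (sum μ ≟ n) ⟧ * N ^ length μ ∎
  where
  open ≡-Reasoning
  wc = weakCompositions n N
  gs = allVec N (length μ)

sum-content : ∀ N B T → Vec.sum (content N B T) ≡ length B
sum-content N B T = begin
  Vec.sum (content N B T)                                  ≡⟨ sum-tabulate {N} _ ⟩
  ∑ (allFin N) _                                           ≡⟨ ∑-cong (allFin N) (λ i → length-filter (λ p → value (toℕ (lookup T p)) ≟ toℕ i) ps) ⟩
  ∑ (allFin N) (λ i → ∑ ps (λ p → f i p))                  ≡⟨ ∑-swap f (allFin N) ps ⟩
  ∑ ps (λ p → ∑ (allFin N) (λ i → f i p))                  ≡⟨ ∑-cong ps (λ p → trans (∑-cong (allFin N) (λ i → cong ⟦_⟧ (sameValue p i))) (∑-δ (v p) 1)) ⟩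
  ∑ ps (λ _ → 1)                                           ≡⟨ trans (∑-1 ps) (length-allFin (length B)) ⟩
  length B                                                 ∎
  where
  open ≡-Reasoning
  ps = allFin (length B)
  f : Fin N → Fin (length B) → ℕ
  f i p = ⟦ does (value (toℕ (lookup T p)) ≟ toℕ i) ⟧
  -- Codes lie below `2 * N`, so halving lands in `Fin N` and each box is counted under exactly one
  -- index `i`.
  value<N : ∀ (c : Fin (2 * N)) → value (toℕ c) < N
  value<N c = m<n*o⇒m/o<n (subst (toℕ c <_) (*-comm 2 N) (Fin.toℕ<n c))
  v : Fin (length B) → Fin N
  v p = fromℕ< (value<N (lookup T p))
  sameValue : ∀ p i → does (value (toℕ (lookup T p)) ≟ toℕ i) ≡ does (v p Fin.≟ i)
  sameValue p i = does-⇔ (mk⇔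
    (λ eq → Fin.toℕ-injective (trans (Fin.toℕ-fromℕ< (value<N (lookup T p))) eq))
    (λ eq → trans (sym (Fin.toℕ-fromℕ< (value<N (lookup T p)))) (cong toℕ eq)))
    (value (toℕ (lookup T p)) ≟ toℕ i) (v p Fin.≟ i)

tableauCount : List (ℕ × ℕ) → ℕ → ℕ
tableauCount B N = ∑ (allVec (2 * N) (length B)) (λ T → ⟦ does (isMarkedShiftedTableau? N B T) ⟧)

-- Each box adds one to the content, so every tableau has degree `length B` and none is lost by
-- summing over this one degree.
∑-rCoeff : ∀ B N → ∑ (weakCompositions (length B) N) (rCoeff B N) ≡ tableauCount B N
∑-rCoeff B N = begin
  ∑ wc (rCoeff B N)
    ≡⟨ ∑-cong wc (λ a → trans (length-filter (λ T → isMarkedShiftedTableau? N B T ×-dec content N B T ≟ᵥ a) Ts)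
         (∑-cong Ts (λ T → ⟦∧⟧ (does (isMarkedShiftedTableau? N B T)) _))) ⟩
  ∑ wc (λ a → ∑ Ts (λ T → mst T * ⟦ does (content N B T ≟ᵥ a) ⟧))
    ≡⟨ ∑-fibres (content N B) mst Ts ⟩
  ∑ Ts (λ T → mst T * ⟦ does (Vec.sum (content N B T) ≟ length B) ⟧)
    ≡⟨ ∑-cong Ts (λ T → trans (cong (λ b → mst T * ⟦ b ⟧) (dec-true (Vec.sum (content N B T) ≟ length B) (sum-content N B T))) (*-identityʳ _)) ⟩
  tableauCount B N ∎
  where
  open ≡-Reasoning
  wc = weakCompositions (length B) N
  Ts = allVec (2 * N) (length B)
  mst : Vec (Fin (2 * N)) (length B) → ℕ
  mst T = ⟦ does (isMarkedShiftedTableau? N B T) ⟧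

-- Ribbon tableaux as words

isMarked? : ∀ c → Dec (IsMarked c)
isMarked? c = c % 2 ≟ 0

infix 4 _⊲_ _⊲?_
-- x ⊲ y: x may stand immediately left of y in a row.  Its negation says that y may stand
-- immediately above x in a column, which is why ribbon tableaux are words with a prescribed descent set.
_⊲_ : Fin m → Fin m → Set
x ⊲ y = toℕ x < toℕ y ⊎ (x ≡ y × ¬ IsMarked (toℕ x))

_⊲?_ : (x y : Fin m) → Dec (x ⊲ y)
x ⊲? y = (toℕ x <? toℕ y) ⊎-dec ((x Fin.≟ y) ×-dec ¬? (isMarked? (toℕ x)))

⊲⇒≤ : {x y : Fin m} → x ⊲ y → toℕ x ≤ toℕ y
⊲⇒≤ (inj₁ x<y) = <⇒≤ x<y
⊲⇒≤ (inj₂ (refl , _)) = ≤-refl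

⋪⇒≥ : {x y : Fin m} → ¬ (x ⊲ y) → toℕ y ≤ toℕ x
⋪⇒≥ x⋪y = ≮⇒≥ (x⋪y ∘ inj₁)

⊲-trans : {x y z : Fin m} → x ⊲ y → y ⊲ z → x ⊲ z
⊲-trans (inj₁ x<y) y⊲z = inj₁ (<-≤-trans x<y (⊲⇒≤ y⊲z))
⊲-trans (inj₂ (refl , _)) y⊲z = y⊲z

-- The complement of `_⊲_` is transitive as well: this reduces a column condition to neighbours, as
-- `⊲-trans` does for rows. If `x` equals `z`, both inequalities force `y` to coincide with them.
⋪-trans : {x y z : Fin m} → ¬ (x ⊲ y) → ¬ (y ⊲ z) → ¬ (x ⊲ z)
⋪-trans x⋪y y⋪z (inj₁ x<z) = <⇒≱ x<z (≤-trans (⋪⇒≥ y⋪z) (⋪⇒≥ x⋪y))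
⋪-trans {x = x} {y} x⋪y y⋪z (inj₂ (refl , unmarked)) =
  x⋪y (inj₂ (Fin.toℕ-injective (≤-antisym (⋪⇒≥ y⋪z) (⋪⇒≥ x⋪y)) , unmarked))

-- Tableau conditions as a relation between pairs of entries

Entry : ℕ → Set
Entry m = (ℕ × ℕ) × Fin m

-- `PairCond` freed from positions, so that it can be used on sublists. The guard `p ≢ q` disappears
-- because only entries at distinct positions are compared.
Compatible : Entry m → Entry m → Set
Compatible ((r , c) , t) ((r′ , c′) , t′) =
  (r ≡ r′ → c < c′ → toℕ t ≤ toℕ t′) ×
  (c ≡ c′ → r < r′ → toℕ t ≤ toℕ t′) ×
  (c ≡ c′ → t ≡ t′ → IsMarked (toℕ t)) ×
  (r ≡ r′ → t ≡ t′ → ¬ IsMarked (toℕ t))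

compatible? : (e e′ : Entry m) → Dec (Compatible e e′)
compatible? ((r , c) , t) ((r′ , c′) , t′) =
  ((r ≟ r′) →-dec ((c <? c′) →-dec (toℕ t ≤? toℕ t′))) ×-dec
  (((c ≟ c′) →-dec ((r <? r′) →-dec (toℕ t ≤? toℕ t′))) ×-dec
   (((c ≟ c′) →-dec ((t Fin.≟ t′) →-dec isMarked? (toℕ t))) ×-dec
    ((r ≟ r′) →-dec ((t Fin.≟ t′) →-dec ¬? (isMarked? (toℕ t))))))

-- Symmetrised because `AllPairs` visits each pair of positions in one order only.
_≬_ : Entry m → Entry m → Set
e ≬ e′ = Compatible e e′ × Compatible e′ e

_≬?_ : (e e′ : Entry m) → Dec (e ≬ e′)
e ≬? e′ = compatible? e e′ ×-dec compatible? e′ e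

≬-row : ∀ {r c c′} {t t′ : Fin m} → c < c′ → ((r , c) , t) ≬ ((r , c′) , t′) ⇔ t ⊲ t′
≬-row {r = r} {c} {c′} {t} {t′} c<c′ = mk⇔ to from
  where
  to : ((r , c) , t) ≬ ((r , c′) , t′) → t ⊲ t′
  to ((t≤t′ , _ , _ , unmarked) , _) with m≤n⇒m<n∨m≡n (t≤t′ refl c<c′)
  ... | inj₁ t<t′ = inj₁ t<t′
  ... | inj₂ t≡t′ = inj₂ (Fin.toℕ-injective t≡t′ , unmarked refl (Fin.toℕ-injective t≡t′))
  unmarked : t ⊲ t′ → t ≡ t′ → ¬ IsMarked (toℕ t)
  unmarked (inj₁ t<t′) refl = contradiction t<t′ (<-irrefl refl)
  unmarked (inj₂ (_ , u)) refl = u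
  from : t ⊲ t′ → ((r , c) , t) ≬ ((r , c′) , t′)
  from t⊲t′ =
    ((λ _ _ → ⊲⇒≤ t⊲t′) , (λ c≡c′ → contradiction c≡c′ (<⇒≢ c<c′)) ,
      (λ c≡c′ → contradiction c≡c′ (<⇒≢ c<c′)) , (λ _ → unmarked t⊲t′)) ,
    ((λ _ c′<c → contradiction c′<c (<⇒≯ c<c′)) , (λ c′≡c → contradiction (sym c′≡c) (<⇒≢ c<c′)) ,
      (λ c′≡c → contradiction (sym c′≡c) (<⇒≢ c<c′)) , λ { _ refl → unmarked t⊲t′ refl })

≬-column : ∀ {r r′ c} {t t′ : Fin m} → r < r′ → ((r , c) , t) ≬ ((r′ , c) , t′) ⇔ (¬ (t′ ⊲ t))
≬-column {r = r} {r′} {c} {t} {t′} r<r′ = mk⇔ to from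
  where
  to : ((r , c) , t) ≬ ((r′ , c) , t′) → ¬ (t′ ⊲ t)
  to ((_ , t≤t′ , _) , _) (inj₁ t′<t) = <⇒≱ t′<t (t≤t′ refl r<r′)
  to (_ , (_ , _ , marked , _)) (inj₂ (t′≡t , u)) = u (marked refl t′≡t)
  marked : ¬ (t′ ⊲ t) → t ≡ t′ → IsMarked (toℕ t)
  marked t′⋪t refl = decidable-stable (isMarked? (toℕ t)) (λ u → t′⋪t (inj₂ (refl , u)))
  from : ¬ (t′ ⊲ t) → ((r , c) , t) ≬ ((r′ , c) , t′)
  from t′⋪t =
    ((λ r≡r′ → contradiction r≡r′ (<⇒≢ r<r′)) , (λ _ _ → ⋪⇒≥ t′⋪t) ,
      (λ _ → marked t′⋪t) , (λ r≡r′ → contradiction r≡r′ (<⇒≢ r<r′))) ,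
    ((λ r′≡r → contradiction (sym r′≡r) (<⇒≢ r<r′)) , (λ _ r′<r → contradiction r′<r (<⇒≯ r<r′)) ,
      (λ { _ refl → marked t′⋪t refl }) , (λ r′≡r → contradiction (sym r′≡r) (<⇒≢ r<r′)))

≬-apart : ∀ {r r′ c c′} {t t′ : Fin m} → r ≢ r′ → c ≢ c′ → ((r , c) , t) ≬ ((r′ , c′) , t′)
≬-apart r≢r′ c≢c′ =
  ((λ r≡r′ → contradiction r≡r′ r≢r′) , (λ c≡c′ → contradiction c≡c′ c≢c′) ,
    (λ c≡c′ → contradiction c≡c′ c≢c′) , (λ r≡r′ → contradiction r≡r′ r≢r′)) ,
  ((λ r≡r′ → contradiction (sym r≡r′) r≢r′) , (λ c≡c′ → contradiction (sym c≡c′) c≢c′) ,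
    (λ c≡c′ → contradiction (sym c≡c′) c≢c′) , (λ r≡r′ → contradiction (sym r≡r′) r≢r′))

fill : (B : List (ℕ × ℕ)) → Vec X (length B) → List ((ℕ × ℕ) × X)
fill [] [] = []
fill (b ∷ B) (t ∷ T) = (b , t) ∷ fill B T

All-fill⁺ : ∀ {P : (ℕ × ℕ) × X → Set} B T → (∀ q → P (List.lookup B q , lookup T q)) → All P (fill B T)
All-fill⁺ [] [] h = []
All-fill⁺ (b ∷ B) (t ∷ T) h = h zero ∷ All-fill⁺ B T (h ∘ suc)

All-fill⁻ : ∀ {P : (ℕ × ℕ) × X → Set} B T → All P (fill B T) → ∀ q → P (List.lookup B q , lookup T q)
All-fill⁻ (b ∷ B) (t ∷ T) (h ∷ hs) zero = h
All-fill⁻ (b ∷ B) (t ∷ T) (h ∷ hs) (suc q) = All-fill⁻ B T hs q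

All-fill-boxes : ∀ {P : ℕ × ℕ → Set} B (T : Vec X (length B)) → All P B → All (P ∘ proj₁) (fill B T)
All-fill-boxes [] [] [] = []
All-fill-boxes (b ∷ B) (t ∷ T) (h ∷ hs) = h ∷ All-fill-boxes B T hs

Valid : (B : List (ℕ × ℕ)) → Vec (Fin m) (length B) → Set
Valid B T = AllPairs _≬_ (fill B T)

valid? : (B : List (ℕ × ℕ)) (T : Vec (Fin m) (length B)) → Dec (Valid B T)
valid? B T = allPairs? _≬?_ (fill B T)

module _ {m : ℕ} where

  PairwiseCompatible : (B : List (ℕ × ℕ)) → Vec (Fin m) (length B) → Set
  PairwiseCompatible B T =
    ∀ p q → p ≢ q → Compatible (List.lookup B p , lookup T p) (List.lookup B q , lookup T q)

  pairwise⇒valid : ∀ B T → PairwiseCompatible B T → Valid B T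
  pairwise⇒valid [] [] h = []
  pairwise⇒valid (b ∷ B) (t ∷ T) h =
    All-fill⁺ B T (λ q → h zero (suc q) (λ ()) , h (suc q) zero (λ ())) ∷
    pairwise⇒valid B T (λ p q p≢q → h (suc p) (suc q) (p≢q ∘ Fin.suc-injective))

  valid⇒pairwise : ∀ B T → Valid B T → PairwiseCompatible B T
  valid⇒pairwise (b ∷ B) (t ∷ T) (h ∷ hs) zero zero p≢q = contradiction refl p≢q
  valid⇒pairwise (b ∷ B) (t ∷ T) (h ∷ hs) zero (suc q) p≢q = proj₁ (All-fill⁻ B T h q)
  valid⇒pairwise (b ∷ B) (t ∷ T) (h ∷ hs) (suc p) zero p≢q = proj₂ (All-fill⁻ B T h p)
  valid⇒pairwise (b ∷ B) (t ∷ T) (h ∷ hs) (suc p) (suc q) p≢q = valid⇒pairwise B T hs p q (p≢q ∘ cong suc)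

tableau⇔valid : ∀ N B T → IsMarkedShiftedTableau N B T ⇔ Valid B T
tableau⇔valid N B T = mk⇔
  (λ h → pairwise⇒valid B T (λ p q → to p q (h p q)))
  (λ v p q → from p q (valid⇒pairwise B T v p q))
  where
  to : ∀ p q → PairCond N B T p q → p ≢ q → Compatible (List.lookup B p , lookup T p) (List.lookup B q , lookup T q)
  to p q (row , column , marked , unmarked) p≢q = row , column , marked p≢q , unmarked p≢q
  from : ∀ p q → (p ≢ q → Compatible (List.lookup B p , lookup T p) (List.lookup B q , lookup T q)) → PairCond N B T p q
  from p q h with p Fin.≟ q
  -- On the diagonal every condition is vacuous: the first two ask for a strict inequality, the last
  -- two for `p ≢ p`.
  ... | yes refl = (λ _ c<c → contradiction c<c (<-irrefl refl)) , (λ _ r<r → contradiction r<r (<-irrefl refl)) ,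
                   (λ p≢p → contradiction refl p≢p) , (λ p≢p → contradiction refl p≢p)
  ... | no p≢q with h p≢q
  ...   | row , column , marked , unmarked = row , column , (λ _ → marked) , (λ _ → unmarked)

-- Splitting a ribbon into its top row and the rest

cells : ℕ → ℕ → ℕ → List (ℕ × ℕ)
cells r c zero = []
cells r c (suc k) = (r , c) ∷ cells r (suc c) k

-- The ribbon of the composition (β₁ + 1, …, β_ℓ + 1).
rows : ℕ → List ℕ → List (ℕ × ℕ)
rows r [] = []
rows r (b ∷ β) = cells r (suc (sum β)) (suc b) ++ rows (suc r) β

map-cells : ∀ r c k → map (λ j → r , c + j) (upTo k) ≡ cells r c k
map-cells r c zero = refl
map-cells r c (suc k) = cong₂ _∷_ (cong (r ,_) (+-identityʳ c)) (begin
  map (λ j → r , c + j) (applyUpTo suc k)      ≡⟨ cong (map _) (sym (map-applyUpTo id suc k)) ⟩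
  map (λ j → r , c + j) (map suc (upTo k))     ≡⟨ sym (map-∘ (upTo k)) ⟩
  map (λ j → r , c + suc j) (upTo k)           ≡⟨ map-cong (λ j → cong (r ,_) (+-suc c j)) (upTo k) ⟩
  map (λ j → r , suc c + j) (upTo k)           ≡⟨ map-cells r (suc c) k ⟩
  cells r (suc c) k                            ∎)
  where open ≡-Reasoning

offset-suc : ∀ β → offset (map suc β) ≡ sum β
offset-suc [] = refl
offset-suc (b ∷ β) = cong (b +_) (offset-suc β)

ribbonBoxesFrom-suc : ∀ r β → ribbonBoxesFrom r (map suc β) ≡ rows r β
ribbonBoxesFrom-suc r [] = refl
ribbonBoxesFrom-suc r (b ∷ β) = cong₂ _++_
  (trans (map-cells r (suc (offset (map suc β))) (suc b)) (cong (λ s → cells r (suc s) (suc b)) (offset-suc β)))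
  (ribbonBoxesFrom-suc (suc r) β)

cells-bounds : ∀ r c k → All (λ b → r ≡ proj₁ b × suc (proj₂ b) ≤ c + k) (cells r c k)
cells-bounds r c zero = []
cells-bounds r c (suc k) rewrite +-suc c k = (refl , s≤s (m≤m+n c k)) ∷ cells-bounds r (suc c) k

-- A row placed on top of `rows r β` starts in column `suc (sum β)`; hence it can share a column
-- with the boxes below only at its leftmost box.
rows-bounds : ∀ r β → All (λ b → r ≤ proj₁ b × proj₂ b ≤ suc (sum β)) (rows r β)
rows-bounds r [] = []
rows-bounds r (b ∷ β) = All.++⁺
  (All.map (λ (r≡ , c<) → ≤-reflexive r≡ , ≤-pred (≤-trans c< (≤-reflexive (cong suc (trans (+-suc (sum β) b) (cong suc (+-comm (sum β) b)))))))
    (cells-bounds r (suc (sum β)) (suc b)))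
  (All.map (λ (r< , c≤) → <⇒≤ r< , ≤-trans c≤ (s≤s (m≤n+m (sum β) b))) (rows-bounds (suc r) β))

append : ∀ k {r c B} → Vec X k → Vec X (length B) → Vec X (length (cells r c k ++ B))
append zero [] T₂ = T₂
append (suc k) (t ∷ T₁) T₂ = t ∷ append k T₁ T₂

∑-append : ∀ k {r c B} (f : Vec (Fin m) (length (cells r c k ++ B)) → ℕ) →
  ∑ (allVec m (length (cells r c k ++ B))) f ≡
  ∑ (allVec m k) (λ T₁ → ∑ (allVec m (length B)) (λ T₂ → f (append k T₁ T₂)))
∑-append zero f = sym (+-identityʳ _)
∑-append {m} (suc k) {r} {c} {B} f = begin
  ∑ (allVec m (suc (length (cells r (suc c) k ++ B)))) f
    ≡⟨ ∑-allVec-suc f ⟩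
  ∑ (allFin m) (λ i → ∑ (allVec m (length (cells r (suc c) k ++ B))) (λ T → f (i ∷ T)))
    ≡⟨ ∑-cong (allFin m) (λ i → ∑-append k {r} {suc c} {B} (λ T → f (i ∷ T))) ⟩
  ∑ (allFin m) (λ i → ∑ (allVec m k) (λ T₁ → ∑ (allVec m (length B)) (λ T₂ → f (i ∷ append k T₁ T₂))))
    ≡⟨ sym (∑-allVec-suc {m} {k} (λ T₁ → ∑ (allVec m (length B)) (λ T₂ → f (append (suc k) T₁ T₂)))) ⟩
  ∑ (allVec m (suc k)) (λ T₁ → ∑ (allVec m (length B)) (λ T₂ → f (append (suc k) T₁ T₂))) ∎
  where open ≡-Reasoning

fillRow : ∀ {k} → ℕ → ℕ → Vec X k → List ((ℕ × ℕ) × X)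
fillRow r c [] = []
fillRow r c (t ∷ T) = ((r , c) , t) ∷ fillRow r (suc c) T

fill-append : ∀ {k r c} B (T₁ : Vec X k) (T₂ : Vec X (length B)) →
  fill (cells r c k ++ B) (append k T₁ T₂) ≡ fillRow r c T₁ ++ fill B T₂
fill-append B [] T₂ = refl
fill-append B (t ∷ T₁) T₂ = cong (_ ∷_) (fill-append B T₁ T₂)

end : ∀ {k} → Vec X (suc k) → X
end (x ∷ []) = x
end (x ∷ y ∷ v) = end (y ∷ v)

-- The rightmost letter of the top row, which lies directly below the leftmost box of any row placed
-- on top. It is the only letter through which that row interacts with the ribbon.
rowEnd : ∀ k {r c B} → Vec X (length (cells r c (suc k) ++ B)) → X
rowEnd zero (t ∷ T) = t
rowEnd (suc k) (t ∷ T) = rowEnd k T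

rowEnd-append : ∀ k {r c B} (T₁ : Vec X (suc k)) (T₂ : Vec X (length B)) →
  rowEnd k {r} {c} {B} (append (suc k) T₁ T₂) ≡ end T₁
rowEnd-append zero (t ∷ []) T₂ = refl
rowEnd-append (suc k) {r} {c} {B} (t ∷ u ∷ T₁) T₂ = rowEnd-append k {r} {suc c} {B} (u ∷ T₁) T₂

AllPairs-++⁻ : ∀ {A : Set} {R : A → A → Set} xs {ys} → AllPairs R (xs ++ ys) →
  AllPairs R xs × AllPairs R ys × All (λ x → All (R x) ys) xs
AllPairs-++⁻ [] h = [] , h , []
AllPairs-++⁻ (x ∷ xs) (h ∷ hs) =
  let (hxs , hys , hxy) = AllPairs-++⁻ xs hs in All.++⁻ˡ xs h ∷ hxs , hys , All.++⁻ʳ xs h ∷ hxy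

fillRow-⊲ : ∀ {k r c c′} {x : Fin m} → c < c′ → (T : Vec (Fin m) k) →
  All (((r , c) , x) ≬_) (fillRow r c′ T) ⇔ All (x ⊲_) (toList T)
fillRow-⊲ c<c′ [] = mk⇔ (λ _ → []) (λ _ → [])
fillRow-⊲ c<c′ (y ∷ T) = mk⇔
  (λ { (h ∷ hs) → Equivalence.to (≬-row c<c′) h ∷ Equivalence.to (fillRow-⊲ (m<n⇒m<1+n c<c′) T) hs })
  (λ { (h ∷ hs) → Equivalence.from (≬-row c<c′) h ∷ Equivalence.from (fillRow-⊲ (m<n⇒m<1+n c<c′) T) hs })

fillRow-valid : ∀ {k} r c (T : Vec (Fin m) k) → AllPairs _≬_ (fillRow r c T) ⇔ AllPairs _⊲_ (toList T)
fillRow-valid r c [] = mk⇔ (λ _ → []) (λ _ → [])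
fillRow-valid r c (x ∷ T) = mk⇔
  (λ { (h ∷ hs) → Equivalence.to (fillRow-⊲ ≤-refl T) h ∷ Equivalence.to (fillRow-valid r (suc c) T) hs })
  (λ { (h ∷ hs) → Equivalence.from (fillRow-⊲ ≤-refl T) h ∷ Equivalence.from (fillRow-valid r (suc c) T) hs })

fillRow-linked : ∀ {k} r c (T : Vec (Fin m) k) → AllPairs _≬_ (fillRow r c T) ⇔ Linked _⊲_ (toList T)
fillRow-linked r c T = mk⇔ (AllPairs⇒Linked ∘ Equivalence.to (fillRow-valid r c T))
  (Equivalence.from (fillRow-valid r c T) ∘ Linked⇒AllPairs ⊲-trans)

All-rowEnd : ∀ {P : (ℕ × ℕ) × X → Set} k {r c B} T →
  All P (fill (cells r c (suc k) ++ B) T) → P ((r , c + k) , rowEnd k {r} {c} {B} T)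
All-rowEnd {P = P} zero {r} {c} (t ∷ T) (h ∷ _) = subst (λ s → P ((r , s) , t)) (sym (+-identityʳ c)) h
All-rowEnd {P = P} (suc k) {r} {c} {B} (t ∷ T) (_ ∷ hs) =
  subst (λ s → P ((r , s) , rowEnd k {r} {suc c} {B} T)) (sym (+-suc c k)) (All-rowEnd {P = P} k {r} {suc c} {B} T hs)

-- A top row with a single box may sit on a longer column. All letters of that column are therefore
-- compared with the topmost one, so that a new row needs to be tested against that letter only.
column-below-rowEnd : ∀ k {r c B} (T : Vec (Fin m) (length (cells r c (suc k) ++ B))) →
  All (λ b → r < proj₁ b) B → Valid (cells r c (suc k) ++ B) T →
  All (λ e → proj₂ (proj₁ e) ≡ c + k → rowEnd k {r} {c} {B} T ≡ proj₂ e ⊎ ¬ (proj₂ e ⊲ rowEnd k {r} {c} {B} T))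
    (fill (cells r c (suc k) ++ B) T)
column-below-rowEnd zero {r} {c} {B} (t ∷ T) r<B (h ∷ _) =
  (λ _ → inj₁ refl) ∷
  All.zipWith (λ { {(_ , _) , _} (t≬ , r<r′) c′≡c → inj₂ (Equivalence.to (≬-column r<r′)
    (subst (λ s → (_ ≬ ((_ , s) , _))) (trans c′≡c (+-identityʳ c)) t≬)) })
    (h , All-fill-boxes B T r<B)
column-below-rowEnd (suc k) {r} {c} {B} (t ∷ T) r<B (_ ∷ hs) =
  (λ c≡ → contradiction c≡ (<⇒≢ (m<m+n c z<s))) ∷
  All.map (λ h c′≡ → h (trans c′≡ (+-suc c k))) (column-below-rowEnd k {r} {suc c} {B} T r<B hs)

module _ {k b : ℕ} {β : List ℕ} (r : ℕ) (T₁ : Vec (Fin m) (suc k)) (T₂ : Vec (Fin m) (length (rows (suc r) (b ∷ β)))) where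

  private
    B₂ : List (ℕ × ℕ)
    B₂ = rows (suc r) (b ∷ β)
    c : ℕ
    c = suc (sum (b ∷ β))
    z : Fin m
    z = rowEnd b {suc r} {suc (sum β)} {rows (suc (suc r)) β} T₂

  row-junction⁻ : All (λ e → All (e ≬_) (fill B₂ T₂)) (fillRow r c T₁) → ¬ (z ⊲ head T₁)
  row-junction⁻ h = to T₁ h
    where
    to : (T₁ : Vec (Fin m) (suc k)) → All (λ e → All (e ≬_) (fill B₂ T₂)) (fillRow r c T₁) → ¬ (z ⊲ head T₁)
    to (x ∷ _) (h ∷ _) = Equivalence.to (≬-column ≤-refl)
      (subst (λ s → ((r , c) , x) ≬ ((suc r , s) , z)) (cong suc (+-comm (sum β) b))
        (All-rowEnd b {suc r} {suc (sum β)} {rows (suc (suc r)) β} T₂ h))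

  -- Boxes of the new row after the first lie strictly right of everything below, and boxes outside
  -- the column of the first box are unrelated to it. The rest of that column follows from the
  -- single comparison with `z`.
  row-junction⁺ : Valid B₂ T₂ → ¬ (z ⊲ head T₁) → All (λ e → All (e ≬_) (fill B₂ T₂)) (fillRow r c T₁)
  row-junction⁺ v = from T₁
    where
    bounds : All (λ e → (suc r ≤ proj₁ (proj₁ e)) × (proj₂ (proj₁ e) ≤ c)) (fill B₂ T₂)
    bounds = All-fill-boxes B₂ T₂ (rows-bounds (suc r) (b ∷ β))
    right : ∀ {k c′} → c < c′ → (T : Vec (Fin m) k) → All (λ e → All (e ≬_) (fill B₂ T₂)) (fillRow r c′ T)
    right c<c′ [] = []
    right c<c′ (y ∷ T) =
      All.map (λ (r<r″ , c″≤c) → ≬-apart (<⇒≢ r<r″) (≢-sym (<⇒≢ (≤-<-trans c″≤c c<c′)))) bounds ∷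
      right (m<n⇒m<1+n c<c′) T
    from : (T₁ : Vec (Fin m) (suc k)) → ¬ (z ⊲ head T₁) → All (λ e → All (e ≬_) (fill B₂ T₂)) (fillRow r c T₁)
    from (x ∷ T) z⋪x = All.zipWith first (column-below-rowEnd b {suc r} {suc (sum β)} {rows (suc (suc r)) β} T₂
        (All.map proj₁ (rows-bounds (suc (suc r)) β)) v , bounds) ∷ right ≤-refl T
      where
      first : ∀ {e} → (proj₂ (proj₁ e) ≡ suc (sum β) + b → z ≡ proj₂ e ⊎ ¬ (proj₂ e ⊲ z)) ×
        (suc r ≤ proj₁ (proj₁ e)) × (proj₂ (proj₁ e) ≤ c) → ((r , c) , x) ≬ e
      first {(r′ , c′) , t} (below , r<r′ , c′≤c) with c′ ≟ c
      ... | no c′≢c = ≬-apart (<⇒≢ r<r′) (≢-sym c′≢c)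
      ... | yes refl with below (cong suc (+-comm b (sum β)))
      ...   | inj₁ refl = Equivalence.from (≬-column r<r′) z⋪x
      -- A letter further down the column: chain it to `x` through `z`.
      ...   | inj₂ t⋪z = Equivalence.from (≬-column r<r′) (⋪-trans t⋪z z⋪x)

  -- The source of the transfer step: top row and lower ribbon are independent except for one
  -- comparison at the junction.
  append-valid : Valid (rows r (k ∷ b ∷ β)) (append (suc k) T₁ T₂) ⇔
    (Linked _⊲_ (toList T₁) × Valid B₂ T₂ × ¬ (z ⊲ head T₁))
  append-valid = mk⇔ to from
    where
    to : Valid (rows r (k ∷ b ∷ β)) (append (suc k) T₁ T₂) → Linked _⊲_ (toList T₁) × Valid B₂ T₂ × ¬ (z ⊲ head T₁)
    to v = let (v₁ , v₂ , v₁₂) = AllPairs-++⁻ (fillRow r c T₁) (subst (AllPairs _≬_) (fill-append B₂ T₁ T₂) v) in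
      Equivalence.to (fillRow-linked r c T₁) v₁ , v₂ , row-junction⁻ v₁₂
    from : Linked _⊲_ (toList T₁) × Valid B₂ T₂ × ¬ (z ⊲ head T₁) → Valid (rows r (k ∷ b ∷ β)) (append (suc k) T₁ T₂)
    from (l , v₂ , z⋪x) = subst (AllPairs _≬_) (sym (fill-append B₂ T₁ T₂))
      (AllPairs.++⁺ (Equivalence.from (fillRow-linked r c T₁) l) v₂ (row-junction⁺ v₂ z⋪x))

-- Transfer operators that count words with prescribed descents

up down : (Fin m → ℕ) → Fin m → ℕ
up {m} φ z = ∑ (allFin m) (λ x → ⟦ does (z ⊲? x) ⟧ * φ x)
down {m} φ z = ∑ (allFin m) (λ x → ⟦ not (does (z ⊲? x)) ⟧ * φ x)

up^ : ℕ → (Fin m → ℕ) → Fin m → ℕ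
up^ zero φ = φ
up^ (suc k) φ = up (up^ k φ)

-- Words read along the ribbon (β₁ + 1, …) from its bottom left end, weighted by φ at the last letter.
words : ℕ → List ℕ → (Fin m → ℕ) → ℕ
words {m} b [] φ = ∑ (allFin m) (up^ b φ)
words b (b′ ∷ β) φ = words b′ β (down (up^ b φ))

-- The arbitrary head weight `w` carries the induction: once the first letter is removed, its
-- comparison with the next letter becomes the new head weight. Later the same slot holds the
-- comparison with the row below.
∑-linked : ∀ b (w φ : Fin m → ℕ) →
  ∑ (allVec m (suc b)) (λ T → ⟦ does (linked? _⊲?_ (toList T)) ⟧ * (w (head T) * φ (end T)))
    ≡ ∑ (allFin m) (λ x → w x * up^ b φ x)
∑-linked {m} zero w φ = trans (∑-allVec-suc {m} {0} _)
  (∑-cong (allFin m) (λ x → trans (+-identityʳ _) (+-identityʳ _)))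
∑-linked {m} (suc b) w φ = begin
  ∑ (allVec m (suc (suc b))) (λ T → L T * (w (head T) * φ (end T)))
    ≡⟨ ∑-allVec-suc {m} {suc b} _ ⟩
  ∑ (allFin m) (λ x → ∑ (allVec m (suc b)) (λ T → L (x ∷ T) * (w x * φ (end (x ∷ T)))))
    ≡⟨ ∑-cong (allFin m) (λ x → trans (∑-cong (allVec m (suc b)) (step x))
         (trans (∑-*ˡ (w x) _ (allVec m (suc b))) (cong (w x *_) (∑-linked b (λ y → ⟦ does (x ⊲? y) ⟧) φ)))) ⟩
  ∑ (allFin m) (λ x → w x * up^ (suc b) φ x) ∎
  where
  open ≡-Reasoning
  L : ∀ {k} → Vec (Fin m) k → ℕ
  L T = ⟦ does (linked? _⊲?_ (toList T)) ⟧
  rearrange : ∀ d l w p → d * l * (w * p) ≡ w * (l * (d * p))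
  rearrange = ℕ-Solver.solve-∀
  step : ∀ x (T : Vec (Fin m) (suc b)) →
    L (x ∷ T) * (w x * φ (end (x ∷ T))) ≡ w x * (L T * (⟦ does (x ⊲? head T) ⟧ * φ (end T)))
  step x (y ∷ T) = trans (cong (_* (w x * φ (end (y ∷ T)))) (⟦∧⟧ (does (x ⊲? y)) _))
    (rearrange ⟦ does (x ⊲? y) ⟧ (L (y ∷ T)) (w x) (φ (end (y ∷ T))))

-- The weight `φ` on the last letter of the top row is what makes the rows separable: summing out
-- the top row leaves the lower ribbon with the weight `down (up^ b φ)` at the junction.
∑-valid : ∀ r b β (φ : Fin m → ℕ) →
  ∑ (allVec m (length (rows r (b ∷ β))))
    (λ T → ⟦ does (valid? (rows r (b ∷ β)) T) ⟧ * φ (rowEnd b {r} {suc (sum β)} {rows (suc r) β} T))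
  ≡ words b β φ
∑-valid {m} r b [] φ = begin
  ∑ (allVec m (length (rows r (b ∷ [])))) _
    ≡⟨ ∑-append {m} (suc b) {r} {1} {[]} _ ⟩
  ∑ (allVec m (suc b)) _
    ≡⟨ ∑-cong (allVec m (suc b)) (λ T → trans (+-identityʳ _) (cong₂ _*_ (cong ⟦_⟧ (does-⇔ (single T)
         (valid? (rows r (b ∷ [])) (append (suc b) T [])) (linked? _⊲?_ (toList T))))
         (trans (cong φ (rowEnd-append b {r} {1} {[]} T [])) (sym (+-identityʳ _))))) ⟩
  ∑ (allVec m (suc b)) (λ T → ⟦ does (linked? _⊲?_ (toList T)) ⟧ * (1 * φ (end T)))
    ≡⟨ ∑-linked b (λ _ → 1) φ ⟩
  ∑ (allFin m) (λ x → 1 * up^ b φ x)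
    ≡⟨ ∑-cong (allFin m) (λ x → +-identityʳ _) ⟩
  words b [] φ ∎
  where
  open ≡-Reasoning
  single : (T : Vec (Fin m) (suc b)) → Valid (rows r (b ∷ [])) (append (suc b) T []) ⇔ Linked _⊲_ (toList T)
  single T = mk⇔
    (λ v → Equivalence.to (fillRow-linked r 1 T)
      (proj₁ (AllPairs-++⁻ (fillRow r 1 T) (subst (AllPairs _≬_) (fill-append [] T []) v))))
    (λ l → subst (AllPairs _≬_) (sym (fill-append [] T []))
      (AllPairs.++⁺ (Equivalence.from (fillRow-linked r 1 T) l) [] (All.universal (λ _ → []) _)))
∑-valid {m} r b (b′ ∷ β) φ = begin
  ∑ (allVec m (length (rows r (b ∷ b′ ∷ β)))) _
    ≡⟨ ∑-append {m} (suc b) {r} {suc (sum (b′ ∷ β))} {B₂} _ ⟩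
  ∑ Ts₁ (λ T₁ → ∑ Ts₂ (λ T₂ → ⟦ does (valid? (rows r (b ∷ b′ ∷ β)) (append (suc b) T₁ T₂)) ⟧ * φ (top (append (suc b) T₁ T₂))))
    ≡⟨ ∑-cong Ts₁ (λ T₁ → ∑-cong Ts₂ (λ T₂ → split T₁ T₂)) ⟩
  ∑ Ts₁ (λ T₁ → ∑ Ts₂ (λ T₂ → V T₂ * (L T₁ * (D (z T₂) (head T₁) * φ (end T₁)))))
    ≡⟨ ∑-swap (λ T₁ T₂ → V T₂ * (L T₁ * (D (z T₂) (head T₁) * φ (end T₁)))) Ts₁ Ts₂ ⟩
  ∑ Ts₂ (λ T₂ → ∑ Ts₁ (λ T₁ → V T₂ * (L T₁ * (D (z T₂) (head T₁) * φ (end T₁)))))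
    ≡⟨ ∑-cong Ts₂ (λ T₂ → trans (∑-*ˡ (V T₂) _ Ts₁) (cong (V T₂ *_) (∑-linked b (D (z T₂)) φ))) ⟩
  ∑ Ts₂ (λ T₂ → V T₂ * down (up^ b φ) (z T₂))
    ≡⟨ ∑-valid (suc r) b′ β (down (up^ b φ)) ⟩
  words b (b′ ∷ β) φ ∎
  where
  open ≡-Reasoning
  B₂ = rows (suc r) (b′ ∷ β)
  Ts₁ = allVec m (suc b)
  Ts₂ = allVec m (length B₂)
  top : Vec (Fin m) (length (rows r (b ∷ b′ ∷ β))) → Fin m
  top = rowEnd b {r} {suc (sum (b′ ∷ β))} {B₂}
  z : Vec (Fin m) (length B₂) → Fin m
  z = rowEnd b′ {suc r} {suc (sum β)} {rows (suc (suc r)) β}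
  V : Vec (Fin m) (length B₂) → ℕ
  V T₂ = ⟦ does (valid? B₂ T₂) ⟧
  L : Vec (Fin m) (suc b) → ℕ
  L T₁ = ⟦ does (linked? _⊲?_ (toList T₁)) ⟧
  D : Fin m → Fin m → ℕ
  D z x = ⟦ not (does (z ⊲? x)) ⟧
  rearrange : ∀ l v d p → l * (v * d) * p ≡ v * (l * (d * p))
  rearrange = ℕ-Solver.solve-∀
  split : ∀ T₁ T₂ → ⟦ does (valid? (rows r (b ∷ b′ ∷ β)) (append (suc b) T₁ T₂)) ⟧ * φ (top (append (suc b) T₁ T₂))
    ≡ V T₂ * (L T₁ * (D (z T₂) (head T₁) * φ (end T₁)))
  split T₁ T₂ = begin
    ⟦ does (valid? (rows r (b ∷ b′ ∷ β)) (append (suc b) T₁ T₂)) ⟧ * φ (top (append (suc b) T₁ T₂))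
      ≡⟨ cong₂ (λ x y → ⟦ x ⟧ * φ y)
           (does-⇔ (append-valid {b = b′} {β} r T₁ T₂) (valid? (rows r (b ∷ b′ ∷ β)) (append (suc b) T₁ T₂))
             (linked? _⊲?_ (toList T₁) ×-dec (valid? B₂ T₂ ×-dec ¬? (z T₂ ⊲? head T₁))))
           (rowEnd-append b {r} {suc (sum (b′ ∷ β))} {B₂} T₁ T₂) ⟩
    ⟦ does (linked? _⊲?_ (toList T₁)) ∧ (does (valid? B₂ T₂) ∧ not (does (z T₂ ⊲? head T₁))) ⟧ * φ (end T₁)
      ≡⟨ cong (_* φ (end T₁)) (trans (⟦∧⟧ (does (linked? _⊲?_ (toList T₁))) _) (cong (L T₁ *_) (⟦∧⟧ (does (valid? B₂ T₂)) _))) ⟩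
    L T₁ * (V T₂ * D (z T₂) (head T₁)) * φ (end T₁)
      ≡⟨ rearrange (L T₁) (V T₂) (D (z T₂) (head T₁)) (φ (end T₁)) ⟩
    V T₂ * (L T₁ * (D (z T₂) (head T₁) * φ (end T₁))) ∎

one : Fin m → ℕ
one _ = 1

tableauCount-ribbon : ∀ b β N → tableauCount (ribbon (map suc (b ∷ β))) N ≡ words {2 * N} b β one
tableauCount-ribbon b β N = begin
  tableauCount (ribbon (map suc (b ∷ β))) N ≡⟨ cong (λ B → tableauCount B N) (ribbonBoxesFrom-suc 1 (b ∷ β)) ⟩
  tableauCount (rows 1 (b ∷ β)) N           ≡⟨ ∑-cong Ts (λ T → trans (cong ⟦_⟧ (does-⇔ (tableau⇔valid N (rows 1 (b ∷ β)) T)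
                                                 (isMarkedShiftedTableau? N (rows 1 (b ∷ β)) T) (valid? (rows 1 (b ∷ β)) T))) (sym (*-identityʳ _))) ⟩
  _                                         ≡⟨ ∑-valid 1 b β one ⟩
  words b β one                             ∎
  where
  open ≡-Reasoning
  Ts = allVec (2 * N) (length (rows 1 (b ∷ β)))

-- The linear term of the number of words

∑-weighted-cong : ∀ (w : Fin m → ℕ) {φ ψ : Fin m → ℕ} → (∀ x → φ x ≡ ψ x) → ∑ (allFin m) (λ x → w x * φ x) ≡ ∑ (allFin m) (λ x → w x * ψ x)
∑-weighted-cong {m} w φ≗ψ = ∑-cong (allFin m) (λ x → cong (w x *_) (φ≗ψ x))

∑-weighted-+ : ∀ (w φ ψ : Fin m → ℕ) →
  ∑ (allFin m) (λ x → w x * (φ x + ψ x)) ≡ ∑ (allFin m) (λ x → w x * φ x) + ∑ (allFin m) (λ x → w x * ψ x)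
∑-weighted-+ {m} w φ ψ = trans (∑-cong (allFin m) (λ x → *-distribˡ-+ (w x) (φ x) (ψ x))) (∑-+ _ _ (allFin m))

∑-weighted-* : ∀ (w φ : Fin m → ℕ) c →
  ∑ (allFin m) (λ x → w x * (φ x * c)) ≡ ∑ (allFin m) (λ x → w x * φ x) * c
∑-weighted-* {m} w φ c = trans (∑-cong (allFin m) (λ x → sym (*-assoc (w x) (φ x) c))) (∑-*ʳ c _ (allFin m))

up^-cong : ∀ k {φ ψ : Fin m → ℕ} → (∀ x → φ x ≡ ψ x) → ∀ z → up^ k φ z ≡ up^ k ψ z
up^-cong zero φ≗ψ = φ≗ψ
up^-cong (suc k) φ≗ψ z = ∑-weighted-cong (λ x → ⟦ does (z ⊲? x) ⟧) (up^-cong k φ≗ψ)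

down-cong : {φ ψ : Fin m → ℕ} → (∀ x → φ x ≡ ψ x) → ∀ z → down φ z ≡ down ψ z
down-cong φ≗ψ z = ∑-weighted-cong (λ x → ⟦ not (does (z ⊲? x)) ⟧) φ≗ψ

words-cong : ∀ b β {φ ψ : Fin m → ℕ} → (∀ x → φ x ≡ ψ x) → words b β φ ≡ words b β ψ
words-cong {m} b [] φ≗ψ = ∑-cong (allFin m) (up^-cong b φ≗ψ)
words-cong b (b′ ∷ β) φ≗ψ = words-cong b′ β (down-cong (up^-cong b φ≗ψ))

up^-+ : ∀ k (φ ψ : Fin m → ℕ) z → up^ k (λ x → φ x + ψ x) z ≡ up^ k φ z + up^ k ψ z
up^-+ zero φ ψ z = refl
up^-+ (suc k) φ ψ z = trans (∑-weighted-cong (λ x → ⟦ does (z ⊲? x) ⟧) (up^-+ k φ ψ)) (∑-weighted-+ (λ x → ⟦ does (z ⊲? x) ⟧) (up^ k φ) (up^ k ψ))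

words-+ : ∀ b β (φ ψ : Fin m → ℕ) → words b β (λ x → φ x + ψ x) ≡ words b β φ + words b β ψ
words-+ {m} b [] φ ψ = trans (∑-cong (allFin m) (up^-+ b φ ψ)) (∑-+ (up^ b φ) (up^ b ψ) (allFin m))
words-+ b (b′ ∷ β) φ ψ = trans
  (words-cong b′ β (λ z → trans (down-cong (up^-+ b φ ψ) z) (∑-weighted-+ (λ x → ⟦ not (does (z ⊲? x)) ⟧) (up^ b φ) (up^ b ψ))))
  (words-+ b′ β (down (up^ b φ)) (down (up^ b ψ)))

up^-* : ∀ k (φ : Fin m → ℕ) c z → up^ k (λ x → φ x * c) z ≡ up^ k φ z * c
up^-* zero φ c z = refl
up^-* (suc k) φ c z = trans (∑-weighted-cong (λ x → ⟦ does (z ⊲? x) ⟧) (up^-* k φ c)) (∑-weighted-* (λ x → ⟦ does (z ⊲? x) ⟧) (up^ k φ) c)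

words-* : ∀ b β (φ : Fin m → ℕ) c → words b β (λ x → φ x * c) ≡ words b β φ * c
words-* {m} b [] φ c = trans (∑-cong (allFin m) (up^-* b φ c)) (∑-*ʳ c (up^ b φ) (allFin m))
words-* b (b′ ∷ β) φ c = trans
  (words-cong b′ β (λ z → trans (down-cong (up^-* b φ c) z) (∑-weighted-* (λ x → ⟦ not (does (z ⊲? x)) ⟧) (up^ b φ) c)))
  (words-* b′ β (down (up^ b φ)) c)

up^-up^ : ∀ a k (φ : Fin m → ℕ) → up^ (a + k) φ ≡ up^ a (up^ k φ)
up^-up^ zero k φ = refl
up^-up^ (suc a) k φ = cong up (up^-up^ a k φ)

words-up^ : ∀ a k β (φ : Fin m → ℕ) → words (a + k) β φ ≡ words a β (up^ k φ)
words-up^ {m} a k [] φ = cong (∑ (allFin m)) (up^-up^ a k φ)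
words-up^ a k (b ∷ β) φ = cong (λ ψ → words b β (down ψ)) (up^-up^ a k φ)

-- A junction is either a descent or not, so both cases together impose no condition. The factor `1`
-- is `one z`, the shape from which `words-*` extracts the total.
down+up : ∀ (φ : Fin m → ℕ) z → down φ z + up φ z ≡ 1 * ∑ (allFin m) φ
down+up {m} φ z = begin
  down φ z + up φ z
    ≡⟨ sym (∑-+ _ _ (allFin m)) ⟩
  ∑ (allFin m) (λ x → ⟦ not (does (z ⊲? x)) ⟧ * φ x + ⟦ does (z ⊲? x) ⟧ * φ x)
    ≡⟨ ∑-cong (allFin m) (λ x → trans (sym (*-distribʳ-+ (φ x) ⟦ not (does (z ⊲? x)) ⟧ _)) (cong (_* φ x) (⟦b⟧+⟦¬b⟧ (does (z ⊲? x))))) ⟩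
  ∑ (allFin m) (λ x → 1 * φ x)
    ≡⟨ ∑-*ˡ 1 φ (allFin m) ⟩
  1 * ∑ (allFin m) φ ∎
  where open ≡-Reasoning

-- The product of two ribbons is the sum of their concatenation and their near-concatenation.
words-product : ∀ b b′ β →
  words {m} b (b′ ∷ β) one + words {m} (suc (b′ + b)) β one ≡ words {m} b′ β one * words {m} b [] one
words-product {m} b b′ β = begin
  words b′ β (down ψ) + words (suc (b′ + b)) β one
    -- With each part stored as its size minus one, joining rows `b′` and `b` gives `suc (b′ + b)`;
    -- moving the successor to `b` exposes `up ψ` as the weight after `b′` steps.
    ≡⟨ cong (words b′ β (down ψ) +_) (trans (cong (λ s → words {m} s β one) (sym (+-suc b′ b))) (words-up^ b′ (suc b) β one)) ⟩
  words b′ β (down ψ) + words b′ β (up ψ)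
    ≡⟨ sym (words-+ b′ β (down ψ) (up ψ)) ⟩
  words b′ β (λ z → down ψ z + up ψ z)
    ≡⟨ words-cong b′ β (down+up ψ) ⟩
  words b′ β (λ z → one z * ∑ (allFin m) ψ)
    ≡⟨ words-* b′ β one (∑ (allFin m) ψ) ⟩
  words {m} b′ β one * words {m} b [] one ∎
  where
  open ≡-Reasoning
  ψ : Fin m → ℕ
  ψ = up^ b one

-- One-row counts

∑-allFin-suc² : ∀ (f : Fin (suc (suc m)) → ℕ) →
  ∑ (allFin (suc (suc m))) f ≡ f zero + (f (suc zero) + ∑ (allFin m) (λ x → f (suc (suc x))))
∑-allFin-suc² f = trans (∑-allFin-suc f) (cong (f zero +_) (∑-allFin-suc (f ∘ suc)))

-- Raising codes by two preserves their order and their marking, and the two new smallest letters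
-- never follow a larger one in a row.
up^-suc² : ∀ k (z : Fin m) → up^ k one (suc (suc z)) ≡ up^ k one z
up^-suc² zero z = refl
up^-suc² {m} (suc k) z = trans (∑-allFin-suc² (λ x → ⟦ does (suc (suc z) ⊲? x) ⟧ * up^ k one x))
  (∑-cong (allFin m) (λ x → cong (⟦ does (z ⊲? x) ⟧ *_) (up^-suc² k x)))

-- Splitting off the two smallest letters 1′ (code 0) and 1 (code 1).
up^-1 : ∀ k → up^ {suc (suc m)} (suc k) one (suc zero) ≡ up^ {suc (suc m)} k one (suc zero) + words {m} k [] one
up^-1 {m} k = trans (∑-allFin-suc² (λ x → ⟦ does (suc zero ⊲? x) ⟧ * up^ {suc (suc m)} k one x))
  (cong₂ _+_ (+-identityʳ _) (∑-cong (allFin m) (λ x → trans (+-identityʳ _) (up^-suc² k x))))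

-- The letters 1′ and 1 have the same successors in a row: 1 and everything larger, since 1 may
-- repeat and 1′ may not.
up^-0 : ∀ k → up^ {suc (suc m)} k one zero ≡ up^ {suc (suc m)} k one (suc zero)
up^-0 zero = refl
up^-0 {m} (suc k) = trans (∑-allFin-suc² (λ x → ⟦ does (zero ⊲? x) ⟧ * up^ {suc (suc m)} k one x))
  (trans (cong₂ _+_ (+-identityʳ _) (∑-cong (allFin m) (λ x → trans (+-identityʳ _) (up^-suc² k x)))) (sym (up^-1 {m} k)))

words-suc² : ∀ k → words {suc (suc m)} k [] one ≡ 2 * up^ {suc (suc m)} k one (suc zero) + words {m} k [] one
words-suc² {m} k = trans (∑-allFin-suc² (up^ {suc (suc m)} k one))
  (trans (cong₂ _+_ (up^-0 {m} k) (cong (up^ {suc (suc m)} k one (suc zero) +_) (∑-cong (allFin m) (up^-suc² k))))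
    (double (up^ {suc (suc m)} k one (suc zero)) _))
  where
  double : ∀ u q → u + (u + q) ≡ 2 * u + q
  double = ℕ-Solver.solve-∀

-- rowCount N n counts the one-row tableaux with n boxes; over n, its generating function is ((1 + t) / (1 − t))^N.
rowCount : ℕ → ℕ → ℕ
rowCount N zero = 1
rowCount N (suc n) = words {2 * N} n [] one

-- Coefficient form of `(1 − t) G_{N+1} = (1 + t) G_N` for the generating function `G_N` of
-- `rowCount N`. The count of words from a fixed smallest letter is eliminated between two
-- consecutive lengths.
rowCount-suc : ∀ N n → rowCount (suc N) (suc n) ≡ rowCount (suc N) n + rowCount N n + rowCount N (suc n)
rowCount-suc N zero = trans (cong (λ m → words {m} 0 [] one) (*-suc 2 N)) (words-suc² {2 * N} 0)
rowCount-suc N (suc n) = begin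
  words {2 * suc N} (suc n) [] one
    ≡⟨ cong (λ m → words {m} (suc n) [] one) (*-suc 2 N) ⟩
  words {2 + 2 * N} (suc n) [] one
    ≡⟨ words-suc² {2 * N} (suc n) ⟩
  2 * up^ {2 + 2 * N} (suc n) one (suc zero) + words {2 * N} (suc n) [] one
    ≡⟨ cong (λ u → 2 * u + words {2 * N} (suc n) [] one) (up^-1 {2 * N} n) ⟩
  2 * (u + words {2 * N} n [] one) + words {2 * N} (suc n) [] one
    ≡⟨ rearrange u (words {2 * N} n [] one) _ ⟩
  2 * u + words {2 * N} n [] one + words {2 * N} n [] one + words {2 * N} (suc n) [] one
    ≡⟨ cong (λ s → s + words {2 * N} n [] one + words {2 * N} (suc n) [] one) (sym (words-suc² {2 * N} n)) ⟩
  words {2 + 2 * N} n [] one + words {2 * N} n [] one + words {2 * N} (suc n) [] one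
    ≡⟨ cong (λ m → words {m} n [] one + words {2 * N} n [] one + words {2 * N} (suc n) [] one) (sym (*-suc 2 N)) ⟩
  words {2 * suc N} n [] one + words {2 * N} n [] one + words {2 * N} (suc n) [] one ∎
  where
  open ≡-Reasoning
  u : ℕ
  u = up^ {2 + 2 * N} n one (suc zero)
  rearrange : ∀ u q q′ → 2 * (u + q) + q′ ≡ 2 * u + q + q + q′
  rearrange = ℕ-Solver.solve-∀

rowCount-1 : ∀ N → rowCount N 1 ≡ 2 * N
rowCount-1 zero = refl
rowCount-1 (suc N) = trans (rowCount-suc N 0) (trans (cong (2 +_) (rowCount-1 N)) (sym (*-suc 2 N)))

-- The differential equation (1 − t²) G′ = 2N G of G = ((1 + t) / (1 − t))^N.
rowCount-recurrence : ∀ N n →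
  (2 + n) * rowCount N (2 + n) ≡ n * rowCount N n + 2 * N * rowCount N (1 + n)
rowCount-recurrence zero zero = refl
rowCount-recurrence zero (suc n) = trans (*-zeroʳ (3 + n)) (sym (trans (+-identityʳ (suc n * 0)) (*-zeroʳ (suc n))))
rowCount-recurrence (suc N) zero = begin
  2 * rowCount (suc N) 2
    ≡⟨ cong (2 *_) (trans (rowCount-suc N 1) (cong (λ h₁ → h₁ + g₁ + g₂) (rowCount-suc N 0))) ⟩
  2 * (1 + 1 + g₁ + g₁ + g₂)
    ≡⟨ expand g₁ g₂ ⟩
  4 + 2 * g₁ + 2 * g₁ + 2 * g₂
    ≡⟨ cong₂ (λ x y → 4 + 2 * x + 2 * g₁ + y) (rowCount-1 N) (rowCount-recurrence N 0) ⟩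
  4 + 2 * (2 * N) + 2 * g₁ + 2 * N * g₁
    ≡⟨ collect N g₁ ⟩
  2 * suc N * (1 + 1 + g₁)
    ≡⟨ cong (2 * suc N *_) (sym (rowCount-suc N 0)) ⟩
  2 * suc N * rowCount (suc N) 1 ∎
  where
  open ≡-Reasoning
  g₁ = rowCount N 1
  g₂ = rowCount N 2
  expand : ∀ x y → 2 * (1 + 1 + x + x + y) ≡ 4 + 2 * x + 2 * x + 2 * y
  expand = ℕ-Solver.solve-∀
  collect : ∀ N x → 4 + 2 * (2 * N) + 2 * x + 2 * N * x ≡ 2 * (1 + N) * (1 + 1 + x)
  collect = ℕ-Solver.solve-∀
rowCount-recurrence (suc N) (suc n) = begin
  (3 + n) * h (3 + n)
    ≡⟨ cong ((3 + n) *_) (rowCount-suc N (2 + n)) ⟩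
  (3 + n) * (h (2 + n) + g (2 + n) + g (3 + n))
    -- Splitting `3 + n` as `(2 + n) + 1` on the first two terms makes the recurrence applicable at
    -- `n` for both `suc N` and `N`; only the third term uses it at `suc n`.
    ≡⟨ expand n (h (2 + n)) (g (2 + n)) (g (3 + n)) ⟩
  (2 + n) * h (2 + n) + h (2 + n) + ((2 + n) * g (2 + n) + g (2 + n)) + (3 + n) * g (3 + n)
    ≡⟨ cong₂ _+_ (cong₂ (λ x y → x + h (2 + n) + (y + g (2 + n))) (rowCount-recurrence (suc N) n) (rowCount-recurrence N n))
         (rowCount-recurrence N (suc n)) ⟩
  n * h n + 2 * suc N * h (1 + n) + h (2 + n) + (n * g n + 2 * N * g (1 + n) + g (2 + n))
    + (suc n * g (1 + n) + 2 * N * g (2 + n))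
    ≡⟨ collect n N (h n) (g n) (g (1 + n)) (g (2 + n)) (rowCount-suc N n) (rowCount-suc N (1 + n)) ⟩
  suc n * h (1 + n) + 2 * suc N * h (2 + n) ∎
  where
  open ≡-Reasoning
  g = rowCount N
  h = rowCount (suc N)
  expand : ∀ n x y z → (3 + n) * (x + y + z) ≡ (2 + n) * x + x + ((2 + n) * y + y) + (3 + n) * z
  expand = ℕ-Solver.solve-∀
  identity : ∀ n N h₀ g₀ g₁ g₂ →
    n * h₀ + 2 * (1 + N) * (h₀ + g₀ + g₁) + (h₀ + g₀ + g₁ + g₁ + g₂) + (n * g₀ + 2 * N * g₁ + g₂)
      + ((1 + n) * g₁ + 2 * N * g₂)
    ≡ (1 + n) * (h₀ + g₀ + g₁) + 2 * (1 + N) * (h₀ + g₀ + g₁ + g₁ + g₂)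
  identity = ℕ-Solver.solve-∀
  collect : ∀ n N h₀ g₀ g₁ g₂ {h₁ h₂} → h₁ ≡ h₀ + g₀ + g₁ → h₂ ≡ h₁ + g₁ + g₂ →
    n * h₀ + 2 * suc N * h₁ + h₂ + (n * g₀ + 2 * N * g₁ + g₂) + (suc n * g₁ + 2 * N * g₂)
    ≡ suc n * h₁ + 2 * suc N * h₂
  collect n N h₀ g₀ g₁ g₂ refl refl = identity n N h₀ g₀ g₁ g₂

-- M f is, modulo N², the linear function with slope a; for a polynomial f without constant term,
-- a / M is the coefficient of N.
HasLinearTerm : (ℕ → ℕ) → ℕ → ℤ → Set
HasLinearTerm f M a = ∀ N → ∃[ k ] ⁺ M ℤ.* ⁺ f N ≡ a ℤ.* ⁺ N ℤ.+ k ℤ.* (⁺ N ℤ.* ⁺ N)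

-- In the recurrence the count with one box less is multiplied by `2N` and, once cleared, is itself
-- a multiple of `N`, so it disappears modulo `N²`. Each step of two boxes then scales the slope by
-- `(n + 1) / (n + 3)`; starting from 2 for one box it stays positive for odd sizes.
rowCount-linearTerm : ∀ n → ∃[ M ] ∃[ a ] 0 < M × (suc n % 2 ≡ 1 → 0 < a) ×
  HasLinearTerm (λ N → rowCount N (suc n)) M (⁺ a)
rowCount-linearTerm zero = 1 , 2 , z<s , (λ _ → z<s) , λ N → ⁺ 0 ,
  trans (cong (λ s → ⁺ 1 ℤ.* ⁺ s) (rowCount-1 N)) (trans (ℤ.*-identityˡ _) (trans (ℤ.pos-* 2 N) (sym (ℤ.+-identityʳ _))))
rowCount-linearTerm (suc zero) = 2 , 0 , z<s , (λ ()) , λ N → ⁺ 4 , (begin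
  ⁺ 2 ℤ.* ⁺ rowCount N 2           ≡⟨ sym (ℤ.pos-* 2 (rowCount N 2)) ⟩
  ⁺ (2 * rowCount N 2)             ≡⟨ cong ⁺_ (trans (rowCount-recurrence N 0) (cong (2 * N *_) (rowCount-1 N))) ⟩
  ⁺ (2 * N * (2 * N))              ≡⟨ trans (ℤ.pos-* (2 * N) (2 * N)) (cong₂ ℤ._*_ (ℤ.pos-* 2 N) (ℤ.pos-* 2 N)) ⟩
  ⁺ 2 ℤ.* ⁺ N ℤ.* (⁺ 2 ℤ.* ⁺ N)    ≡⟨ square (⁺ N) ⟩
  ⁺ 0 ℤ.* ⁺ N ℤ.+ ⁺ 4 ℤ.* (⁺ N ℤ.* ⁺ N) ∎)
  where
  open ≡-Reasoning
  square : ∀ x → ⁺ 2 ℤ.* x ℤ.* (⁺ 2 ℤ.* x) ≡ ⁺ 0 ℤ.* x ℤ.+ ⁺ 4 ℤ.* (x ℤ.* x)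
  square = ℤ-Solver.solve-∀
rowCount-linearTerm (suc (suc n)) with rowCount-linearTerm n | rowCount-linearTerm (suc n)
... | M , a , 0<M , 0<a , f-linear | M′ , a′ , 0<M′ , _ , f′-linear =
  -- The quotient of the two is `(a / M) (n + 1) / (n + 3)`.
  M * M′ * (3 + n) , M′ * suc n * a ,
  *-mono-< (*-mono-< 0<M 0<M′) (z<s {2 + n}) , (λ odd → *-mono-< (*-mono-< 0<M′ (z<s {n})) (0<a odd)) , step
  where
  open ≡-Reasoning
  step : HasLinearTerm (λ N → rowCount N (3 + n)) (M * M′ * (3 + n)) (⁺ (M′ * suc n * a))
  step N with f-linear N | f′-linear N
  ... | k , eq | k′ , eq′ = ⁺ M′ ℤ.* ⁺ suc n ℤ.* k ℤ.+ ⁺ M ℤ.* ⁺ 2 ℤ.* (⁺ a′ ℤ.+ k′ ℤ.* ⁺ N) , (begin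
    ⁺ (M * M′ * (3 + n)) ℤ.* ⁺ r₂
      ≡⟨ cong (ℤ._* ⁺ r₂) (trans (ℤ.pos-* (M * M′) (3 + n)) (cong (ℤ._* ⁺ (3 + n)) (ℤ.pos-* M M′))) ⟩
    ⁺ M ℤ.* ⁺ M′ ℤ.* ⁺ (3 + n) ℤ.* ⁺ r₂
      ≡⟨ trans (ℤ.*-assoc (⁺ M ℤ.* ⁺ M′) (⁺ (3 + n)) (⁺ r₂)) (cong (⁺ M ℤ.* ⁺ M′ ℤ.*_) recurrence) ⟩
    ⁺ M ℤ.* ⁺ M′ ℤ.* (⁺ suc n ℤ.* ⁺ r₀ ℤ.+ ⁺ 2 ℤ.* ⁺ N ℤ.* ⁺ r₁)
      ≡⟨ regroup (⁺ M) (⁺ M′) (⁺ suc n) (⁺ N) (⁺ r₀) (⁺ r₁) ⟩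
    ⁺ M′ ℤ.* ⁺ suc n ℤ.* (⁺ M ℤ.* ⁺ r₀) ℤ.+ ⁺ M ℤ.* ⁺ 2 ℤ.* ⁺ N ℤ.* (⁺ M′ ℤ.* ⁺ r₁)
      ≡⟨ cong₂ (λ x y → ⁺ M′ ℤ.* ⁺ suc n ℤ.* x ℤ.+ ⁺ M ℤ.* ⁺ 2 ℤ.* ⁺ N ℤ.* y) eq eq′ ⟩
    ⁺ M′ ℤ.* ⁺ suc n ℤ.* (⁺ a ℤ.* ⁺ N ℤ.+ k ℤ.* (⁺ N ℤ.* ⁺ N)) ℤ.+ ⁺ M ℤ.* ⁺ 2 ℤ.* ⁺ N ℤ.* (⁺ a′ ℤ.* ⁺ N ℤ.+ k′ ℤ.* (⁺ N ℤ.* ⁺ N))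
      ≡⟨ collect (⁺ M) (⁺ M′) (⁺ suc n) (⁺ N) (⁺ a) (⁺ a′) k k′ ⟩
    ⁺ M′ ℤ.* ⁺ suc n ℤ.* ⁺ a ℤ.* ⁺ N ℤ.+ (⁺ M′ ℤ.* ⁺ suc n ℤ.* k ℤ.+ ⁺ M ℤ.* ⁺ 2 ℤ.* (⁺ a′ ℤ.+ k′ ℤ.* ⁺ N)) ℤ.* (⁺ N ℤ.* ⁺ N)
      ≡⟨ cong (λ x → x ℤ.* ⁺ N ℤ.+ _) (sym (trans (ℤ.pos-* (M′ * suc n) a) (cong (ℤ._* ⁺ a) (ℤ.pos-* M′ (suc n))))) ⟩
    ⁺ (M′ * suc n * a) ℤ.* ⁺ N ℤ.+ _ ∎)
    where
    r₀ = rowCount N (suc n)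
    r₁ = rowCount N (2 + n)
    r₂ = rowCount N (3 + n)
    recurrence : ⁺ (3 + n) ℤ.* ⁺ r₂ ≡ ⁺ suc n ℤ.* ⁺ r₀ ℤ.+ ⁺ 2 ℤ.* ⁺ N ℤ.* ⁺ r₁
    recurrence = trans (sym (ℤ.pos-* (3 + n) r₂)) (trans (cong ⁺_ (rowCount-recurrence N (suc n)))
      (trans (ℤ.pos-+ (suc n * r₀) (2 * N * r₁)) (cong₂ ℤ._+_ (ℤ.pos-* (suc n) r₀)
        (trans (ℤ.pos-* (2 * N) r₁) (cong (ℤ._* ⁺ r₁) (ℤ.pos-* 2 N))))))
    regroup : ∀ M M′ s N r₀ r₁ → M ℤ.* M′ ℤ.* (s ℤ.* r₀ ℤ.+ ⁺ 2 ℤ.* N ℤ.* r₁) ≡ M′ ℤ.* s ℤ.* (M ℤ.* r₀) ℤ.+ M ℤ.* ⁺ 2 ℤ.* N ℤ.* (M′ ℤ.* r₁)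
    regroup = ℤ-Solver.solve-∀
    collect : ∀ M M′ s N a a′ k k′ →
      M′ ℤ.* s ℤ.* (a ℤ.* N ℤ.+ k ℤ.* (N ℤ.* N)) ℤ.+ M ℤ.* ⁺ 2 ℤ.* N ℤ.* (a′ ℤ.* N ℤ.+ k′ ℤ.* (N ℤ.* N))
      ≡ M′ ℤ.* s ℤ.* a ℤ.* N ℤ.+ (M′ ℤ.* s ℤ.* k ℤ.+ M ℤ.* ⁺ 2 ℤ.* (a′ ℤ.+ k′ ℤ.* N)) ℤ.* (N ℤ.* N)
    collect = ℤ-Solver.solve-∀

-- Joining the two top rows keeps the number of boxes, hence its parity, and removes one row; so
-- positivity of `a` is inherited from the joined ribbon. The two factors of the product enter only
-- as multiples of `N`, whatever their slopes.
ribbon-linearTerm : ∀ b β → ∃[ M ] ∃[ a ] 0 < M × (sum (map suc (b ∷ β)) % 2 ≡ 1 → 0 < a) ×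
  HasLinearTerm (λ N → words {2 * N} b β one) M (-1ℤ ℤ.^ length β ℤ.* ⁺ a)
ribbon-linearTerm b [] with rowCount-linearTerm b
... | M , a , 0<M , 0<a , linear = M , a , 0<M , (λ odd → 0<a (trans (cong (_% 2) (sym (+-identityʳ (suc b)))) odd)) ,
  λ N → proj₁ (linear N) , trans (proj₂ (linear N)) (cong (λ x → x ℤ.* ⁺ N ℤ.+ _) (sym (ℤ.*-identityˡ (⁺ a))))
ribbon-linearTerm b (b′ ∷ β) with ribbon-linearTerm b′ β | ribbon-linearTerm b [] | ribbon-linearTerm (suc (b′ + b)) β
... | M₁ , a₁ , 0<M₁ , _ , linear₁ | M₂ , a₂ , 0<M₂ , _ , linear₂ | M₃ , a₃ , 0<M₃ , 0<a₃ , linear₃ =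
  M₁ * M₂ * M₃ , M₁ * M₂ * a₃ , *-mono-< 0<M₁₂ 0<M₃ ,
  (λ odd → *-mono-< 0<M₁₂ (0<a₃ (trans (cong (_% 2) (size b b′ (sum (map suc β)))) odd))) , step
  where
  open ≡-Reasoning
  0<M₁₂ : 0 < M₁ * M₂
  0<M₁₂ = *-mono-< 0<M₁ 0<M₂
  size : ∀ b b′ s → 2 + (b′ + b) + s ≡ 1 + b + (1 + b′ + s)
  size = ℕ-Solver.solve-∀
  ε = -1ℤ ℤ.^ length β
  step : HasLinearTerm (λ N → words {2 * N} b (b′ ∷ β) one) (M₁ * M₂ * M₃) (-1ℤ ℤ.* ε ℤ.* ⁺ (M₁ * M₂ * a₃))
  step N with linear₁ N | linear₂ N | linear₃ N
  ... | k₁ , eq₁ | k₂ , eq₂ | k₃ , eq₃ =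
    k , (begin
    ⁺ (M₁ * M₂ * M₃) ℤ.* ⁺ w
      ≡⟨ cong (ℤ._* ⁺ w) (pos-*³ M₁ M₂ M₃) ⟩
    ⁺ M₁ ℤ.* ⁺ M₂ ℤ.* ⁺ M₃ ℤ.* ⁺ w
      ≡⟨ cong (⁺ M₁ ℤ.* ⁺ M₂ ℤ.* ⁺ M₃ ℤ.*_) product ⟩
    ⁺ M₁ ℤ.* ⁺ M₂ ℤ.* ⁺ M₃ ℤ.* (⁺ w₁ ℤ.* ⁺ w₂ ℤ.- ⁺ w₃)
      ≡⟨ regroup (⁺ M₁) (⁺ M₂) (⁺ M₃) (⁺ w₁) (⁺ w₂) (⁺ w₃) ⟩
    ⁺ M₃ ℤ.* (⁺ M₁ ℤ.* ⁺ w₁) ℤ.* (⁺ M₂ ℤ.* ⁺ w₂) ℤ.- ⁺ M₁ ℤ.* ⁺ M₂ ℤ.* (⁺ M₃ ℤ.* ⁺ w₃)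
      ≡⟨ cong₂ (λ x y → x ℤ.- ⁺ M₁ ℤ.* ⁺ M₂ ℤ.* y) (cong₂ (λ x y → ⁺ M₃ ℤ.* x ℤ.* y) eq₁ eq₂) eq₃ ⟩
    -- Both factors of the product have no constant term, so their product goes entirely into the
    -- coefficient of `N²`.
    _ ≡⟨ collect (⁺ M₁) (⁺ M₂) (⁺ M₃) (⁺ N) c₁ (⁺ 1 ℤ.* ⁺ a₂) ε (⁺ a₃) k₁ k₂ k₃ ⟩
    -1ℤ ℤ.* ε ℤ.* (⁺ M₁ ℤ.* ⁺ M₂ ℤ.* ⁺ a₃) ℤ.* ⁺ N ℤ.+ k ℤ.* (⁺ N ℤ.* ⁺ N)
      ≡⟨ cong (λ x → -1ℤ ℤ.* ε ℤ.* x ℤ.* ⁺ N ℤ.+ k ℤ.* (⁺ N ℤ.* ⁺ N)) (sym (pos-*³ M₁ M₂ a₃)) ⟩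
    -1ℤ ℤ.* ε ℤ.* ⁺ (M₁ * M₂ * a₃) ℤ.* ⁺ N ℤ.+ k ℤ.* (⁺ N ℤ.* ⁺ N) ∎)
    where
    c₁ k : ℤ
    c₁ = ε ℤ.* ⁺ a₁
    k = ⁺ M₃ ℤ.* (c₁ ℤ.+ k₁ ℤ.* ⁺ N) ℤ.* (⁺ 1 ℤ.* ⁺ a₂ ℤ.+ k₂ ℤ.* ⁺ N) ℤ.- ⁺ M₁ ℤ.* ⁺ M₂ ℤ.* k₃
    w w₁ w₂ w₃ : ℕ
    w = words {2 * N} b (b′ ∷ β) one
    w₁ = words {2 * N} b′ β one
    w₂ = words {2 * N} b [] one
    w₃ = words {2 * N} (suc (b′ + b)) β one
    pos-*³ : ∀ x y z → ⁺ (x * y * z) ≡ ⁺ x ℤ.* ⁺ y ℤ.* ⁺ z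
    pos-*³ x y z = trans (ℤ.pos-* (x * y) z) (cong (ℤ._* ⁺ z) (ℤ.pos-* x y))
    cancel : ∀ x y → x ≡ x ℤ.+ y ℤ.- y
    cancel = ℤ-Solver.solve-∀
    product : ⁺ w ≡ ⁺ w₁ ℤ.* ⁺ w₂ ℤ.- ⁺ w₃
    product = trans (cancel (⁺ w) (⁺ w₃)) (cong (ℤ._- ⁺ w₃)
      (trans (sym (ℤ.pos-+ w w₃)) (trans (cong ⁺_ (words-product {2 * N} b b′ β)) (ℤ.pos-* w₁ w₂))))
    regroup : ∀ M₁ M₂ M₃ w₁ w₂ w₃ → M₁ ℤ.* M₂ ℤ.* M₃ ℤ.* (w₁ ℤ.* w₂ ℤ.- w₃)
      ≡ M₃ ℤ.* (M₁ ℤ.* w₁) ℤ.* (M₂ ℤ.* w₂) ℤ.- M₁ ℤ.* M₂ ℤ.* (M₃ ℤ.* w₃)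
    regroup = ℤ-Solver.solve-∀
    collect : ∀ M₁ M₂ M₃ N c₁ c₂ ε a₃ k₁ k₂ k₃ →
      M₃ ℤ.* (c₁ ℤ.* N ℤ.+ k₁ ℤ.* (N ℤ.* N)) ℤ.* (c₂ ℤ.* N ℤ.+ k₂ ℤ.* (N ℤ.* N))
        ℤ.- M₁ ℤ.* M₂ ℤ.* (ε ℤ.* a₃ ℤ.* N ℤ.+ k₃ ℤ.* (N ℤ.* N))
      ≡ -1ℤ ℤ.* ε ℤ.* (M₁ ℤ.* M₂ ℤ.* a₃) ℤ.* N
        ℤ.+ (M₃ ℤ.* (c₁ ℤ.+ k₁ ℤ.* N) ℤ.* (c₂ ℤ.+ k₂ ℤ.* N) ℤ.- M₁ ℤ.* M₂ ℤ.* k₃) ℤ.* (N ℤ.* N)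
    collect = ℤ-Solver.solve-∀

-- The linear term of a p-positive function

-- Rationals are kept in lowest terms; identities for `ℕtoℚ` are therefore checked on unnormalised
-- fractions, where they are cross multiplications.
toℚᵘ-ℕtoℚ : ∀ n → ℚ.toℚᵘ (ℕtoℚ n) ℚᵘ.≃ mkℚᵘ (⁺ n) 0
toℚᵘ-ℕtoℚ n = ℚ.toℚᵘ-fromℚᵘ (mkℚᵘ (⁺ n) 0)

ℕtoℚ-injective : ∀ {m n} → ℕtoℚ m ≡ ℕtoℚ n → m ≡ n
ℕtoℚ-injective {m} {n} eq with ℚᵘ.≃-trans (ℚᵘ.≃-sym (toℚᵘ-ℕtoℚ m)) (ℚᵘ.≃-trans (ℚ.toℚᵘ-cong eq) (toℚᵘ-ℕtoℚ n))
... | *≡* m≡n = ℤ.+-injective (trans (sym (ℤ.*-identityʳ (⁺ m))) (trans m≡n (ℤ.*-identityʳ (⁺ n))))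

ℕtoℚ-+ : ∀ m n → ℕtoℚ (m + n) ≡ ℕtoℚ m ℚ.+ ℕtoℚ n
ℕtoℚ-+ m n = ℚ.toℚᵘ-injective (begin
  ℚ.toℚᵘ (ℕtoℚ (m + n))                       ≈⟨ toℚᵘ-ℕtoℚ (m + n) ⟩
  mkℚᵘ (⁺ (m + n)) 0                          ≈⟨ *≡* (trans (cong (ℤ._* ⁺ 1) (ℤ.pos-+ m n)) (units (⁺ m) (⁺ n))) ⟩
  mkℚᵘ (⁺ m) 0 ℚᵘ.+ mkℚᵘ (⁺ n) 0              ≈⟨ ℚᵘ.+-cong (ℚᵘ.≃-sym (toℚᵘ-ℕtoℚ m)) (ℚᵘ.≃-sym (toℚᵘ-ℕtoℚ n)) ⟩
  ℚ.toℚᵘ (ℕtoℚ m) ℚᵘ.+ ℚ.toℚᵘ (ℕtoℚ n)        ≈⟨ ℚᵘ.≃-sym (ℚ.toℚᵘ-homo-+ (ℕtoℚ m) (ℕtoℚ n)) ⟩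
  ℚ.toℚᵘ (ℕtoℚ m ℚ.+ ℕtoℚ n)                  ∎)
  where
  open ≃-Reasoning
  units : ∀ x y → (x ℤ.+ y) ℤ.* ⁺ 1 ≡ (x ℤ.* ⁺ 1 ℤ.+ y ℤ.* ⁺ 1) ℤ.* ⁺ 1
  units = ℤ-Solver.solve-∀

ℕtoℚ-* : ∀ m n → ℕtoℚ (m * n) ≡ ℕtoℚ m ℚ.* ℕtoℚ n
ℕtoℚ-* m n = ℚ.toℚᵘ-injective (begin
  ℚ.toℚᵘ (ℕtoℚ (m * n))                       ≈⟨ toℚᵘ-ℕtoℚ (m * n) ⟩
  mkℚᵘ (⁺ (m * n)) 0                          ≈⟨ *≡* (cong (ℤ._* ⁺ 1) (ℤ.pos-* m n)) ⟩
  mkℚᵘ (⁺ m) 0 ℚᵘ.* mkℚᵘ (⁺ n) 0              ≈⟨ ℚᵘ.*-cong (ℚᵘ.≃-sym (toℚᵘ-ℕtoℚ m)) (ℚᵘ.≃-sym (toℚᵘ-ℕtoℚ n)) ⟩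
  ℚ.toℚᵘ (ℕtoℚ m) ℚᵘ.* ℚ.toℚᵘ (ℕtoℚ n)        ≈⟨ ℚᵘ.≃-sym (ℚ.toℚᵘ-homo-* (ℕtoℚ m) (ℕtoℚ n)) ⟩
  ℚ.toℚᵘ (ℕtoℚ m ℚ.* ℕtoℚ n)                  ∎)
  where open ≃-Reasoning

-- Nonnegativity of the coefficients enters here: the cleared numerator is a natural number, and so
-- will be the slope of the whole expansion.
clearDenominator : ∀ c → 0ℚ ℚ.≤ c → ∃[ q ] ∃[ p ] 0 < q × ℕtoℚ q ℚ.* c ≡ ℕtoℚ p
clearDenominator c@(mkℚ (ℤ.-[1+ p ]) d _) 0≤c with ℚ.nonNegative 0≤c
... | ()
clearDenominator c@(mkℚ (⁺ p) d _) _ = suc d , p , z<s , ℚ.toℚᵘ-injective (begin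
  ℚ.toℚᵘ (ℕtoℚ (suc d) ℚ.* c)                 ≈⟨ ℚ.toℚᵘ-homo-* (ℕtoℚ (suc d)) c ⟩
  ℚ.toℚᵘ (ℕtoℚ (suc d)) ℚᵘ.* mkℚᵘ (⁺ p) d     ≈⟨ ℚᵘ.*-congʳ {mkℚᵘ (⁺ p) d} (toℚᵘ-ℕtoℚ (suc d)) ⟩
  mkℚᵘ (⁺ suc d) 0 ℚᵘ.* mkℚᵘ (⁺ p) d          ≈⟨ *≡* cross ⟩
  mkℚᵘ (⁺ p) 0                                ≈⟨ ℚᵘ.≃-sym (toℚᵘ-ℕtoℚ p) ⟩
  ℚ.toℚᵘ (ℕtoℚ p)                             ∎)
  where
  open ≃-Reasoning
  cross : ⁺ suc d ℤ.* ⁺ p ℤ.* ⁺ 1 ≡ ⁺ p ℤ.* ⁺ suc (d + 0)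
  cross = trans (ℤ.*-identityʳ _) (trans (ℤ.*-comm (⁺ suc d) (⁺ p)) (cong (λ e → ⁺ p ℤ.* ⁺ suc e) (sym (+-identityʳ d))))

regroup-product : ∀ x y c w s → x ℚ.* y ℚ.* (c ℚ.* w ℚ.+ s) ≡ y ℚ.* (x ℚ.* c) ℚ.* w ℚ.+ x ℚ.* (y ℚ.* s)
regroup-product x y c w s = begin
  x ℚ.* y ℚ.* (c ℚ.* w ℚ.+ s)                      ≡⟨ ℚ.*-distribˡ-+ (x ℚ.* y) (c ℚ.* w) s ⟩
  x ℚ.* y ℚ.* (c ℚ.* w) ℚ.+ x ℚ.* y ℚ.* s          ≡⟨ cong₂ ℚ._+_ (sym (ℚ.*-assoc (x ℚ.* y) c w)) (ℚ.*-assoc x y s) ⟩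
  x ℚ.* y ℚ.* c ℚ.* w ℚ.+ x ℚ.* (y ℚ.* s)          ≡⟨ cong (λ z → z ℚ.* c ℚ.* w ℚ.+ x ℚ.* (y ℚ.* s)) (ℚ.*-comm x y) ⟩
  y ℚ.* x ℚ.* c ℚ.* w ℚ.+ x ℚ.* (y ℚ.* s)          ≡⟨ cong (λ z → z ℚ.* w ℚ.+ x ℚ.* (y ℚ.* s)) (ℚ.*-assoc y x c) ⟩
  y ℚ.* (x ℚ.* c) ℚ.* w ℚ.+ x ℚ.* (y ℚ.* s)        ∎
  where open ≡-Reasoning

clear-term : ∀ q p D c w S s → ℕtoℚ q ℚ.* c ≡ ℕtoℚ p → ℕtoℚ D ℚ.* S ≡ ℕtoℚ s →
  ℕtoℚ (q * D) ℚ.* (c ℚ.* ℕtoℚ w ℚ.+ S) ≡ ℕtoℚ (D * p * w + q * s)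
clear-term q p D c w S s qc≡p DS≡s = begin
  ℕtoℚ (q * D) ℚ.* (c ℚ.* ℕtoℚ w ℚ.+ S)
    ≡⟨ cong (ℚ._* (c ℚ.* ℕtoℚ w ℚ.+ S)) (ℕtoℚ-* q D) ⟩
  ℕtoℚ q ℚ.* ℕtoℚ D ℚ.* (c ℚ.* ℕtoℚ w ℚ.+ S)
    ≡⟨ regroup-product (ℕtoℚ q) (ℕtoℚ D) c (ℕtoℚ w) S ⟩
  ℕtoℚ D ℚ.* (ℕtoℚ q ℚ.* c) ℚ.* ℕtoℚ w ℚ.+ ℕtoℚ q ℚ.* (ℕtoℚ D ℚ.* S)
    ≡⟨ cong₂ (λ x y → ℕtoℚ D ℚ.* x ℚ.* ℕtoℚ w ℚ.+ ℕtoℚ q ℚ.* y) qc≡p DS≡s ⟩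
  ℕtoℚ D ℚ.* ℕtoℚ p ℚ.* ℕtoℚ w ℚ.+ ℕtoℚ q ℚ.* ℕtoℚ s
    ≡⟨ cong₂ (λ x y → x ℚ.* ℕtoℚ w ℚ.+ y) (sym (ℕtoℚ-* D p)) (sym (ℕtoℚ-* q s)) ⟩
  ℕtoℚ (D * p) ℚ.* ℕtoℚ w ℚ.+ ℕtoℚ (q * s)
    ≡⟨ cong (ℚ._+ ℕtoℚ (q * s)) (sym (ℕtoℚ-* (D * p) w)) ⟩
  ℕtoℚ (D * p * w) ℚ.+ ℕtoℚ (q * s)
    ≡⟨ sym (ℕtoℚ-+ (D * p * w) (q * s)) ⟩
  ℕtoℚ (D * p * w + q * s) ∎
  where open ≡-Reasoning

-- Quantified over all valuations `v`, because one `D` and one `ds` must serve every number of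
-- variables and every exponent vector.
ClearedBy : ∀ {A : Set} → List (ℚ × A) → ℕ → List (ℕ × A) → Set
ClearedBy {A} ts D ds = ∀ (v : A → ℕ) →
  ℕtoℚ D ℚ.* sumℚ (map (λ t → proj₁ t ℚ.* ℕtoℚ (v (proj₂ t))) ts) ≡ ℕtoℚ (∑ ds (λ d → proj₁ d * v (proj₂ d)))

clearDenominators : ∀ {A : Set} (ts : List (ℚ × A)) → All (λ t → 0ℚ ℚ.≤ proj₁ t) ts →
  ∃[ D ] ∃[ ds ] 0 < D × ClearedBy ts D ds
clearDenominators [] [] = 1 , [] , z<s , λ v → refl
clearDenominators ((c , μ) ∷ ts) (0≤c ∷ 0≤ts) =
  let (q , p , 0<q , qc≡p) = clearDenominator c 0≤c
      (D , ds , 0<D , cleared) = clearDenominators ts 0≤ts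
  in q * D , (D * p , μ) ∷ map (λ d → q * proj₁ d , proj₂ d) ds , *-mono-< 0<q 0<D , λ v →
    trans (clear-term q p D c (v μ) _ (∑ ds (λ d → proj₁ d * v (proj₂ d))) qc≡p (cleared v))
      (cong (λ x → ℕtoℚ (D * p * v μ + x)) (sym (scaled q ds v)))
  where
  scaled : ∀ q ds v → ∑ (map (λ d → q * proj₁ d , proj₂ d) ds) (λ d → proj₁ d * v (proj₂ d)) ≡ q * ∑ ds (λ d → proj₁ d * v (proj₂ d))
  scaled q ds v = trans (∑-map (λ d → proj₁ d * v (proj₂ d)) (λ d → q * proj₁ d , proj₂ d) ds)
    (trans (∑-cong ds (λ d → *-assoc q (proj₁ d) (v (proj₂ d)))) (∑-*ˡ q (λ d → proj₁ d * v (proj₂ d)) ds))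

-- Only a single part can give a linear term; two or more parts give a multiple of `N²`. The degree
-- is a successor so that the constant contribution of the empty partition vanishes.
∑-pCoeff-linearTerm : ∀ n μ → ∃[ e ] ∀ N → ∃[ k ]
  ∑ (weakCompositions (suc n) N) (pCoeff μ N) ≡ e * N + k * (N * N)
∑-pCoeff-linearTerm n [] = 0 , λ N → 0 , ∑-pCoeff [] (suc n) N
∑-pCoeff-linearTerm n (m ∷ []) = ⟦ does (m + 0 ≟ suc n) ⟧ , λ N → 0 ,
  trans (∑-pCoeff (m ∷ []) (suc n) N) (trans (cong (⟦ does (m + 0 ≟ suc n) ⟧ *_) (*-identityʳ N)) (sym (+-identityʳ _)))
∑-pCoeff-linearTerm n μ@(_ ∷ _ ∷ ν) = 0 , λ N → ⟦ does (sum μ ≟ suc n) ⟧ * N ^ length ν ,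
  trans (∑-pCoeff μ (suc n) N) (regroup ⟦ does (sum μ ≟ suc n) ⟧ N (N ^ length ν))
  where
  regroup : ∀ b N x → b * (N * (N * x)) ≡ b * x * (N * N)
  regroup = ℕ-Solver.solve-∀

combination-linearTerm : ∀ n (ds : List (ℕ × List ℕ)) → ∃[ e ] ∀ N → ∃[ k ]
  ∑ ds (λ d → proj₁ d * ∑ (weakCompositions (suc n) N) (pCoeff (proj₂ d) N)) ≡ e * N + k * (N * N)
combination-linearTerm n [] = 0 , λ N → 0 , refl
combination-linearTerm n ((d , μ) ∷ ds) with ∑-pCoeff-linearTerm n μ | combination-linearTerm n ds
... | e₁ , linear₁ | e₂ , linear₂ = d * e₁ + e₂ , λ N → d * proj₁ (linear₁ N) + proj₁ (linear₂ N) ,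
  trans (cong₂ (λ x y → d * x + y) (proj₂ (linear₁ N)) (proj₂ (linear₂ N)))
    (regroup d e₁ e₂ N (proj₁ (linear₁ N)) (proj₁ (linear₂ N)))
  where
  regroup : ∀ d e₁ e₂ N k₁ k₂ → d * (e₁ * N + k₁ * (N * N)) + (e₂ * N + k₂ * (N * N))
    ≡ (d * e₁ + e₂) * N + (d * k₁ + k₂) * (N * N)
  regroup = ℕ-Solver.solve-∀

module _ {F : (N : ℕ) → Vec ℕ N → ℕ} {D : ℕ} {ds : List (ℕ × List ℕ)} (n : ℕ)
  (expansion : ∀ N a → D * F N a ≡ ∑ ds (λ d → proj₁ d * pCoeff (proj₂ d) N a)) where

  ∑-expansion : ∀ N → D * ∑ (weakCompositions n N) (F N)
    ≡ ∑ ds (λ d → proj₁ d * ∑ (weakCompositions n N) (pCoeff (proj₂ d) N))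
  ∑-expansion N = begin
    D * ∑ wc (F N)                                             ≡⟨ sym (∑-*ˡ D (F N) wc) ⟩
    ∑ wc (λ a → D * F N a)                                     ≡⟨ ∑-cong wc (expansion N) ⟩
    ∑ wc (λ a → ∑ ds (λ d → proj₁ d * pCoeff (proj₂ d) N a))   ≡⟨ ∑-swap (λ a d → proj₁ d * pCoeff (proj₂ d) N a) wc ds ⟩
    ∑ ds (λ d → ∑ wc (λ a → proj₁ d * pCoeff (proj₂ d) N a))   ≡⟨ ∑-cong ds (λ d → ∑-*ˡ (proj₁ d) (pCoeff (proj₂ d) N) wc) ⟩
    ∑ ds (λ d → proj₁ d * ∑ wc (pCoeff (proj₂ d) N))           ∎
    where
    open ≡-Reasoning
    wc = weakCompositions n N

naturalExpansion : ∀ {F : (N : ℕ) → Vec ℕ N → ℕ} → PPositive F → ∃[ D ] ∃[ ds ] 0 < D ×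
  (∀ N a → D * F N a ≡ ∑ ds (λ d → proj₁ d * pCoeff (proj₂ d) N a))
naturalExpansion {F} (ts , conditions , expansion) =
  let (D , ds , 0<D , cleared) = clearDenominators ts (All.map proj₁ conditions)
  in D , ds , 0<D , λ N a → ℕtoℚ-injective (trans (ℕtoℚ-* D (F N a))
    (trans (cong (ℕtoℚ D ℚ.*_) (expansion N a)) (cleared (λ μ → pCoeff μ N a))))

-- The slope e / D is the coefficient of p_n, because p_μ(1, …, 1) = N^ℓ(μ).
positive-linearTerm : ∀ {F : (N : ℕ) → Vec ℕ N → ℕ} n → PPositive F → ∃[ D ] ∃[ e ] 0 < D × (∀ N → ∃[ k ]
  D * ∑ (weakCompositions (suc n) N) (F N) ≡ e * N + k * (N * N))
positive-linearTerm {F} n positive =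
  let (D , ds , 0<D , expansion) = naturalExpansion {F} positive
      (e , linear) = combination-linearTerm n ds
  in D , e , 0<D , λ N → proj₁ (linear N) ,
    trans (∑-expansion {F} {D} {ds} (suc n) expansion N) (proj₂ (linear N))

-- Slopes of opposite sign

-1^odd : ∀ n → n % 2 ≡ 1 → -1ℤ ℤ.^ n ≡ -1ℤ
-1^odd (suc zero) _ = refl
-1^odd (suc (suc n)) odd = cong (λ x → -1ℤ ℤ.* (-1ℤ ℤ.* x)) (-1^odd n odd)

odd-pred : ∀ n → suc n % 2 ≡ 0 → n % 2 ≡ 1
odd-pred (suc zero) _ = refl
odd-pred (suc (suc n)) even = odd-pred n even

-- Eliminating `f N` gives `(M e + D a) N = (D k′ − M k) N²`, so `N` divides `s = M e + D a`. Since
-- `s` is positive, the single value `N = s + 1` is contradictory, whatever `k` and `k′` are there.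
linearTerms-disagree : ∀ {f D e M a} → 0 < D → 0 < M → 0 < a →
  (∀ N → ∃[ k ] D * f N ≡ e * N + k * (N * N)) → ¬ HasLinearTerm f M (-1ℤ ℤ.* ⁺ a)
linearTerms-disagree {f} {D} {e} {M} {a} 0<D 0<M 0<a f-slope f-slope′ with f-slope (suc (M * e + D * a)) | f-slope′ (suc (M * e + D * a))
... | k , eq | k′ , eq′ = contradiction (divides ℤ.∣ j ∣ s≡) (>⇒∤ {{>-nonZero 0<s}} ≤-refl)
  where
  s N : ℕ
  s = M * e + D * a
  N = suc s
  j : ℤ
  j = ⁺ D ℤ.* k′ ℤ.- ⁺ M ℤ.* ⁺ k
  0<s : 0 < s
  0<s = <-≤-trans (*-mono-< 0<D 0<a) (m≤n+m (D * a) (M * e))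
  eqℤ : ⁺ D ℤ.* ⁺ f N ≡ ⁺ e ℤ.* ⁺ N ℤ.+ ⁺ k ℤ.* (⁺ N ℤ.* ⁺ N)
  eqℤ = trans (sym (ℤ.pos-* D (f N))) (trans (cong ⁺_ eq) (trans (ℤ.pos-+ (e * N) (k * (N * N)))
    (cong₂ ℤ._+_ (ℤ.pos-* e N) (trans (ℤ.pos-* k (N * N)) (cong (⁺ k ℤ.*_) (ℤ.pos-* N N))))))
  eliminate : ∀ M D e a k k′ N f → D ℤ.* f ≡ e ℤ.* N ℤ.+ k ℤ.* (N ℤ.* N) →
    M ℤ.* f ≡ -1ℤ ℤ.* a ℤ.* N ℤ.+ k′ ℤ.* (N ℤ.* N) →
    (M ℤ.* e ℤ.+ D ℤ.* a) ℤ.* N ≡ (D ℤ.* k′ ℤ.- M ℤ.* k) ℤ.* N ℤ.* N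
  eliminate M D e a k k′ N f eq₁ eq₂ = begin
    (M ℤ.* e ℤ.+ D ℤ.* a) ℤ.* N
      ≡⟨ expand M D e a k k′ N ⟩
    M ℤ.* (e ℤ.* N ℤ.+ k ℤ.* (N ℤ.* N)) ℤ.- D ℤ.* (-1ℤ ℤ.* a ℤ.* N ℤ.+ k′ ℤ.* (N ℤ.* N)) ℤ.+ R
      ≡⟨ cong₂ (λ x y → M ℤ.* x ℤ.- D ℤ.* y ℤ.+ R) (sym eq₁) (sym eq₂) ⟩
    M ℤ.* (D ℤ.* f) ℤ.- D ℤ.* (M ℤ.* f) ℤ.+ R
      ≡⟨ cancel M D f R ⟩
    R ∎
    where
    open ≡-Reasoning
    R = (D ℤ.* k′ ℤ.- M ℤ.* k) ℤ.* N ℤ.* N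
    expand : ∀ M D e a k k′ N → (M ℤ.* e ℤ.+ D ℤ.* a) ℤ.* N ≡
      M ℤ.* (e ℤ.* N ℤ.+ k ℤ.* (N ℤ.* N)) ℤ.- D ℤ.* (-1ℤ ℤ.* a ℤ.* N ℤ.+ k′ ℤ.* (N ℤ.* N)) ℤ.+ (D ℤ.* k′ ℤ.- M ℤ.* k) ℤ.* N ℤ.* N
    expand = ℤ-Solver.solve-∀
    cancel : ∀ M D f R → M ℤ.* (D ℤ.* f) ℤ.- D ℤ.* (M ℤ.* f) ℤ.+ R ≡ R
    cancel = ℤ-Solver.solve-∀
  s≡ : s ≡ ℤ.∣ j ∣ * N
  s≡ = trans (cong ℤ.∣_∣ (trans (trans (ℤ.pos-+ (M * e) (D * a)) (cong₂ ℤ._+_ (ℤ.pos-* M e) (ℤ.pos-* D a)))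
    (ℤ.*-cancelʳ-≡ _ (j ℤ.* ⁺ N) (⁺ N) (eliminate (⁺ M) (⁺ D) (⁺ e) (⁺ a) (⁺ k) k′ (⁺ N) (⁺ f N) eqℤ eq′))))
    (ℤ.abs-* j (⁺ N))

composition-suc : ∀ {α} → IsComposition α → ∃[ β ] α ≡ map {A = ℕ} suc β
composition-suc [] = [] , refl
composition-suc {suc b ∷ _} (_ ∷ positive) with composition-suc positive
... | β , refl = b ∷ β , refl

ribbon-count : ∀ b β N → let B = ribbon (map suc (b ∷ β)) in
  ∑ (weakCompositions (length B) N) (rCoeff B N) ≡ words {2 * N} b β one
ribbon-count b β N = trans (∑-rCoeff (ribbon (map suc (b ∷ β))) N) (tableauCount-ribbon b β N)

ribbon-not-positive : ∀ (β : List ℕ) → sum (map suc β) % 2 ≡ 1 → length (map {B = ℕ} suc β) % 2 ≡ 0 →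
  ¬ PPositive (𝔯 (map suc β))
-- The empty composition is ruled out by its sum being even.
ribbon-not-positive (b ∷ β) odd even positive =
  let (M , a , 0<M , 0<a , linear) = ribbon-linearTerm b β
      -- The top row has a box, so `length B` computes to a successor and `suc (pred (length B))` is
      -- the degree itself.
      (D , e , 0<D , positive-linear) = positive-linearTerm {rCoeff B} (pred (length B)) positive
  in linearTerms-disagree {λ N → words {2 * N} b β one} {D} {e} {M} {a} 0<D 0<M (0<a odd)
    (λ N → proj₁ (positive-linear N) , trans (cong (D *_) (sym (ribbon-count b β N))) (proj₂ (positive-linear N)))
    (subst (λ ε → HasLinearTerm (λ N → words {2 * N} b β one) M (ε ℤ.* ⁺ a)) (-1^odd (length β) oddTail) linear)
  where
  B : List (ℕ × ℕ)
  B = ribbon (map suc (b ∷ β))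
  oddTail : length β % 2 ≡ 1
  oddTail = odd-pred (length β) (trans (cong (λ l → suc l % 2) (sym (length-map {B = ℕ} suc β))) even)

theorem4p13 : (α : List ℕ) → IsComposition α →
    sum α % 2 ≡ 1 → ¬ IsBasicBlock α → length α % 2 ≡ 0 →
    ¬ PPositive (𝔯 α)
theorem4p13 α composition odd _ even =
  let (β , α≡) = composition-suc composition
  in subst (λ α → sum α % 2 ≡ 1 → length α % 2 ≡ 0 → ¬ PPositive (𝔯 α)) (sym α≡) (ribbon-not-positive β) odd even
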